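{- Let $k\ge 4$, $n$ and $r$ be integers with $2k\le n\le 3k-2$ and $r>2(k-1)$, such that there exists at least one $r$-regular graph on $n$ vertices with chromatic number $k$. Then $d(n,r,\chi=k)=k-1$.
   Context: All graphs are finite and simple. For a graph $G$, $\chi(G)$ denotes its chromatic number. A set $S$ of vertices of $G$ together with an assignment of colors to the vertices of $S$ is a defining set of the vertex coloring of $G$ if this partial coloring extends in exactly one way to a proper coloring of all vertices of $G$ with $\chi(G)$ colors. The defining number $d(G,\chi)$ is the minimum cardinality of a defining set of $G$. For integers $n,r,k$, $d(n,r,\chi=k)$ denotes the minimum of $d(G,\chi)$ over all $r$-regular graphs $G$ on $n$ vertices with $\chi(G)=k$. -}

module Defs where

open import Data.Nat using (ℕ; _<_; _≤_)
open import Data.Fin using (Fin)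
open import Data.Fin.Subset using (Subset; _∈_; ∣_∣)
open import Data.Bool using (Bool; true; false; if_then_else_)
open import Data.List using (List; allFin; map)
open import Data.Nat.ListAction using (sum)
open import Data.Product using (Σ; _×_; ∃)
open import Relation.Binary.PropositionalEquality using (_≡_; _≢_)
open import Relation.Nullary using (¬_)

record Graph (n : ℕ) : Set where
  field
    adj     : Fin n → Fin n → Bool
    adj-sym : ∀ u v → adj u v ≡ adj v u
    irrefl  : ∀ v → adj v v ≡ false
open Graph public

degree : ∀ {n} → Graph n → Fin n → ℕ
degree {n} G v = sum (map (λ u → if adj G v u then 1 else 0) (allFin n))

Regular : ∀ {n} → ℕ → Graph n → Set
Regular r G = ∀ v → degree G v ≡ r

Proper : ∀ {n k} → Graph n → (Fin n → Fin k) → Set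
Proper G c = ∀ u v → adj G u v ≡ true → c u ≢ c v

Colorable : ∀ {n} → Graph n → ℕ → Set
Colorable {n} G k = Σ (Fin n → Fin k) (Proper G)

ChromaticNumber : ∀ {n} → Graph n → ℕ → Set
ChromaticNumber G k = Colorable G k × (∀ m → m < k → ¬ Colorable G m)

-- The vertex set S together with the colouring f restricted to S
-- (values of f outside S are irrelevant) is a defining set of the
-- k-colourings of G: it extends to exactly one proper k-colouring.
IsDefiningSet : ∀ {n} → Graph n → (k : ℕ) → Subset n → (Fin n → Fin k) → Set
IsDefiningSet {n} G k S f =
  (Σ (Fin n → Fin k) λ c → Proper G c × (∀ v → v ∈ S → c v ≡ f v))
  × (∀ c c′ → Proper G c → Proper G c′
       → (∀ v → v ∈ S → c v ≡ f v) → (∀ v → v ∈ S → c′ v ≡ f v)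
       → ∀ v → c v ≡ c′ v)

HasDefiningSetOfSize : ∀ {n} → Graph n → ℕ → ℕ → Set
HasDefiningSetOfSize {n} G k m =
  Σ (Subset n) λ S → Σ (Fin n → Fin k) λ f → IsDefiningSet G k S f × ∣ S ∣ ≡ m

DefiningNumber : ∀ {n} → Graph n → ℕ → ℕ → Set
DefiningNumber G k m =
  HasDefiningSetOfSize G k m × (∀ m′ → HasDefiningSetOfSize G k m′ → m ≤ m′)

InClass : ∀ {n} → ℕ → ℕ → Graph n → Set
InClass r k G = Regular r G × ChromaticNumber G k

DefNum : ℕ → ℕ → ℕ → ℕ → Set
DefNum n r k m =
  (Σ (Graph n) λ G → InClass r k G × DefiningNumber G k m)
  × (∀ (G : Graph n) → InClass r k G → ∀ m′ → DefiningNumber G k m′ → m ≤ m′)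

{-# OPTIONS --safe #-}
-- Lower bound: if a defining set misses two colours, exchanging them gives a second
-- extension, as a χ-colouring uses every colour; so at most one colour is missed.
--
-- Upper bound: pass to the complement H of the graph, which is d-regular with
-- d = n − 1 − r.  Write n = 2k + f; then 2 ≤ d ≤ f ≤ k − 2, and d f is even by the
-- handshake lemma.  H gets vertices a₀ … aₖ₋₁, b₀ … bₖ₋₁, c₀ … c_{f−1}, with the a's and
-- the b's independent, so that each colour class (a clique of H) contains exactly one
-- a and one b.  Precolour the aᵢ with 0 < i < cut and the bᵢ with cut ≤ i.  If aᵢ ~ bⱼ implies
-- i ≤ j whenever i and j lie on the same side of the cut, and a₀ is joined to no bⱼ beyond it,
-- all a's and b's are forced,
-- and then so is every c adjacent to both aᵢ and bᵢ for only one i.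
--
-- For d ≥ 4 such an H lives on ℤ/k: with h = ⌊d/2⌋ and u = ⌊hf/k⌋, aᵢ is joined to the
-- bⱼ with j − i ∈ [0, d − u), and the c's sit at an equidistributed set F of f residues, the
-- one at t being joined to the aᵢ with t − i ∈ [0, h) and the bⱼ with j − t ∈ [0, h).  Each aᵢ
-- then sees u or u + 1 of the c's; in the latter case the edge from aᵢ to b_{i+h−1} is deleted.
-- For odd d the c's, even in number, are moreover matched in pairs.
-- For d = 2, 3, H consists of copies of K_{d+1} and a bipartite circulant graph.
module Submission where

open import Defs
open import Algebra.Properties.CommutativeMonoid.Sum using ()
open import Data.Bool using (Bool; true; false; if_then_else_; not; _∧_; _∨_)
open import Data.Bool.Properties using (not-involutive; ∧-zeroʳ)
open import Data.Fin as Fin using (Fin; zero; suc; toℕ; fromℕ<; punchOut; _↑ˡ_; _↑ʳ_; splitAt)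
open import Data.Fin.Permutation.Components using (transpose; transpose-inverse)
import Data.Fin.Properties as Fin
open import Data.Fin.Subset using (Subset; _∈_; ∣_∣)
import Data.List as List
import Data.List.Properties as List
open import Data.Nat
open import Data.Nat.DivMod
open import Data.Nat.Induction using (<-rec)
import Data.Nat.ListAction as ListAction
open import Data.Nat.Properties
open import Data.Nat.Tactic.RingSolver using (solve-∀)
open import Data.Product using (Σ; ∃-syntax; _×_; _,_; proj₁; proj₂)
open import Data.Sum using (_⊎_; inj₁; inj₂)
open import Data.Vec as Vec using ([]; _∷_)
import Data.Vec.Properties as Vec
open import Function using (_∘_; id; mk⇔)
open import Relation.Binary.Definitions using (tri<; tri≈; tri>)
open import Relation.Binary.PropositionalEquality
open import Relation.Nullary using (¬_; Dec; does; yes; no; contradiction)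
open import Relation.Nullary.Decidable using (dec-true; dec-false; does-⇔)
open Algebra.Properties.CommutativeMonoid.Sum +-0-commutativeMonoid using (sum; sum-cong-≗; ∑-distrib-+; ∑-comm; sum-replicate-zero)

⟦_⟧ : Bool → ℕ
⟦ b ⟧ = if b then 1 else 0

⟦⟧+⟦not⟧ : ∀ b → ⟦ b ⟧ + ⟦ not b ⟧ ≡ 1
⟦⟧+⟦not⟧ true  = refl
⟦⟧+⟦not⟧ false = refl

holds : ∀ {p} {P : Set p} (P? : Dec P) → does P? ≡ true → P
holds (yes p) _ = p

∧-true : ∀ {x y} → x ∧ y ≡ true → x ≡ true × y ≡ true
∧-true {true} {true} _ = refl , refl

-- Sums over Fin n

sum-const : ∀ n c → sum {n} (λ _ → c) ≡ n * c
sum-const zero    c = refl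
sum-const (suc n) c = cong (c +_) (sum-const n c)

sum-mono : ∀ {n} {f g : Fin n → ℕ} → (∀ i → f i ≤ g i) → sum f ≤ sum g
sum-mono {zero}  f≤g = z≤n
sum-mono {suc n} f≤g = +-mono-≤ (f≤g zero) (sum-mono (f≤g ∘ suc))

term≤sum : ∀ {n} (f : Fin n → ℕ) i → f i ≤ sum f
term≤sum f zero    = m≤m+n _ _
term≤sum f (suc i) = ≤-trans (term≤sum (f ∘ suc) i) (m≤n+m _ _)

sum-↑ : ∀ m {n} (f : Fin (m + n) → ℕ) → sum f ≡ sum (f ∘ (_↑ˡ n)) + sum (f ∘ (m ↑ʳ_))
sum-↑ zero    f = refl
sum-↑ (suc m) f = trans (cong (f zero +_) (sum-↑ m (f ∘ suc))) (sym (+-assoc (f zero) _ _))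

sum-indicator : ∀ {n} (i : Fin n) → sum (λ j → ⟦ does (i Fin.≟ j) ⟧) ≡ 1
sum-indicator {suc n} zero    = cong suc (sum-replicate-zero n)
sum-indicator {suc n} (suc i) = sum-indicator i

sum-complement : ∀ {n} (b : Fin n → Bool) → sum (⟦_⟧ ∘ b) + sum (⟦_⟧ ∘ not ∘ b) ≡ n
sum-complement {n} b = begin
  sum (⟦_⟧ ∘ b) + sum (⟦_⟧ ∘ not ∘ b)      ≡⟨ ∑-distrib-+ (⟦_⟧ ∘ b) (⟦_⟧ ∘ not ∘ b) ⟨
  sum (λ i → ⟦ b i ⟧ + ⟦ not (b i) ⟧)      ≡⟨ sum-cong-≗ (⟦⟧+⟦not⟧ ∘ b) ⟩
  sum {n} (λ _ → 1)                        ≡⟨ sum-const n 1 ⟩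
  n * 1                                    ≡⟨ *-identityʳ n ⟩
  n                                        ∎
  where open ≡-Reasoning

-- Row and column zero contribute the same amount by symmetry and the corner vanishes, so each
-- induction step adds an even number. For an adjacency matrix this is the handshake lemma.
sum-symmetric-even : ∀ {n} (w : Fin n → Fin n → ℕ) → (∀ i j → w i j ≡ w j i) → (∀ i → w i i ≡ 0) →
                     ∃[ m ] sum (λ i → sum (w i)) ≡ m + m
sum-symmetric-even {zero}  w w-sym w-irr = 0 , refl
sum-symmetric-even {suc n} w w-sym w-irr
  with m , eq ← sum-symmetric-even (λ i j → w (suc i) (suc j)) (λ i j → w-sym (suc i) (suc j)) (w-irr ∘ suc)
  = x + m , (begin
  w zero zero + x + sum (λ i → w (suc i) zero + sum (w (suc i) ∘ suc))   ≡⟨ cong₂ (λ s t → s + x + t) (w-irr zero) (∑-distrib-+ (λ i → w (suc i) zero) (λ i → sum (w (suc i) ∘ suc))) ⟩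
  x + (sum (λ i → w (suc i) zero) + sum (λ i → sum (w (suc i) ∘ suc)))   ≡⟨ cong₂ (λ s t → x + (s + t)) (sum-cong-≗ (λ i → w-sym (suc i) zero)) eq ⟩
  x + (x + (m + m))                                                       ≡⟨ rearrange x m ⟩
  x + m + (x + m)                                                         ∎)
  where
  open ≡-Reasoning
  x = sum (w zero ∘ suc)
  rearrange : ∀ x m → x + (x + (m + m)) ≡ x + m + (x + m)
  rearrange = solve-∀

sum-fibres : ∀ {n k} (b : Fin n → ℕ) (c : Fin n → Fin k) →
             sum b ≡ sum (λ x → sum (λ v → b v * ⟦ does (c v Fin.≟ x) ⟧))
sum-fibres b c = begin
  sum b                                                      ≡⟨ sum-cong-≗ expand ⟨
  sum (λ v → sum (λ x → b v * ⟦ does (c v Fin.≟ x) ⟧))        ≡⟨ ∑-comm (λ v x → b v * ⟦ does (c v Fin.≟ x) ⟧) ⟩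
  sum (λ x → sum (λ v → b v * ⟦ does (c v Fin.≟ x) ⟧))        ∎
  where
  open ≡-Reasoning
  pull : ∀ m {k} (f : Fin k → ℕ) → sum (λ x → m * f x) ≡ m * sum f
  pull m {zero}  f = sym (*-zeroʳ m)
  pull m {suc k} f = trans (cong (m * f zero +_) (pull m (f ∘ suc))) (sym (*-distribˡ-+ m (f zero) _))
  expand : ∀ v → sum (λ x → b v * ⟦ does (c v Fin.≟ x) ⟧) ≡ b v
  expand v = trans (pull (b v) (λ x → ⟦ does (c v Fin.≟ x) ⟧)) (trans (cong (b v *_) (sum-indicator (c v))) (*-identityʳ (b v)))

-- At most one term vanishes, so all others contribute at least 1. A vanishing head is that one
-- exception; a positive head pays for itself and the tail is treated by induction.
pred≤sum : ∀ {k} (w : Fin k → ℕ) → (∀ x y → w x ≡ 0 → w y ≡ 0 → x ≡ y) → k ∸ 1 ≤ sum w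
pred≤sum {zero}  w unique = z≤n
pred≤sum {suc k} w unique with w zero in eq
... | suc m = begin
  k                        ≤⟨ m≤n+m∸n k 1 ⟩
  1 + (k ∸ 1)              ≤⟨ s≤s (pred≤sum (w ∘ suc) (λ x y p q → Fin.suc-injective (unique (suc x) (suc y) p q))) ⟩
  1 + sum (w ∘ suc)        ≤⟨ s≤s (m≤n+m _ m) ⟩
  suc m + sum (w ∘ suc)    ∎
  where open ≤-Reasoning
... | zero = begin
  k                        ≡⟨ *-identityʳ k ⟨
  k * 1                    ≡⟨ sum-const k 1 ⟨
  sum {k} (λ _ → 1)        ≤⟨ sum-mono (λ x → n≢0⇒n>0 (λ p → contradiction (unique zero (suc x) eq p) Fin.0≢1+n)) ⟩
  sum (w ∘ suc)            ∎
  where open ≤-Reasoning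

degree≡sum : ∀ {n} (G : Graph n) v → degree G v ≡ sum (λ u → ⟦ adj G v u ⟧)
degree≡sum {n} G v = 
  trans (cong ListAction.sum (List.map-tabulate {n = n} id row)) (sum-tabulate row)
  where
  row : Fin n → ℕ
  row u = ⟦ adj G v u ⟧
  sum-tabulate : ∀ {n} (f : Fin n → ℕ) → ListAction.sum (List.tabulate f) ≡ sum f
  sum-tabulate {zero}  f = refl
  sum-tabulate {suc n} f = cong (f zero +_) (sum-tabulate (f ∘ suc))

∣∣≡sum : ∀ {n} (S : Subset n) → ∣ S ∣ ≡ sum (λ v → ⟦ Vec.lookup S v ⟧)
∣∣≡sum []          = refl
∣∣≡sum (true ∷ S)  = cong suc (∣∣≡sum S)
∣∣≡sum (false ∷ S) = ∣∣≡sum S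

-- Defining sets have at least χ − 1 elements

transpose-injective : ∀ {k} (x y : Fin k) {a b} → transpose x y a ≡ transpose x y b → a ≡ b
transpose-injective x y {a} {b} eq =
  trans (sym (transpose-inverse y x)) (trans (cong (transpose y x) eq) (transpose-inverse y x))

transpose-left : ∀ {k} (x y : Fin k) → transpose x y x ≡ y
transpose-left x y rewrite dec-true (x Fin.≟ x) refl = refl

transpose-other : ∀ {k} {x y z : Fin k} → z ≢ x → z ≢ y → transpose x y z ≡ z
transpose-other {x = x} {y} {z} z≢x z≢y
  rewrite dec-false (z Fin.≟ x) z≢x | dec-false (z Fin.≟ y) z≢y = refl

-- Minimality of the chromatic number is applied through this: a colour that never occurs can be
-- deleted from the palette.
avoid-colour : ∀ {n k} (G : Graph n) (c : Fin n → Fin (suc k)) → Proper G c →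
               ∀ x → (∀ v → x ≢ c v) → Colorable G k
avoid-colour G c proper x x≢c =
  (λ v → punchOut (x≢c v)) , λ u v uv eq → proper u v uv (Fin.punchOut-injective (x≢c u) (x≢c v) eq)

definingSet-bound : ∀ {n k} (G : Graph n) → ChromaticNumber G k → ∀ m → HasDefiningSetOfSize G k m → k ∸ 1 ≤ m
definingSet-bound {k = zero}  G _ m _ = z≤n
definingSet-bound {n} {suc k} G (_ , minimal) m (S , f , ((c , proper , c≡f) , unique) , refl) = begin
  k          ≤⟨ pred≤sum used used-unique ⟩
  sum used   ≡⟨ sum-fibres (λ v → ⟦ Vec.lookup S v ⟧) f ⟨
  sum (λ v → ⟦ Vec.lookup S v ⟧)   ≡⟨ ∣∣≡sum S ⟨
  ∣ S ∣      ∎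
  where
  open ≤-Reasoning
  -- Precoloured vertices are counted with multiplicity, so the total over all colours is exactly
  -- the size of `S`.
  used : Fin (suc k) → ℕ
  used x = sum (λ v → ⟦ Vec.lookup S v ⟧ * ⟦ does (f v Fin.≟ x) ⟧)

  unused : ∀ {x} → used x ≡ 0 → ∀ v → v ∈ S → f v ≢ x
  unused {x} ux≡0 v v∈S fv≡x = 1+n≰n (≤-trans (subst (_≤ used x) one (term≤sum _ v)) (≤-reflexive ux≡0))
    where
    one : ⟦ Vec.lookup S v ⟧ * ⟦ does (f v Fin.≟ x) ⟧ ≡ 1
    one = cong₂ (λ b b′ → ⟦ b ⟧ * ⟦ b′ ⟧) (Vec.[]=⇒lookup v∈S) (dec-true (f v Fin.≟ x) fv≡x)

  -- Exchanging two unused colours yields another extension, so neither of them occurs at all.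
  used-unique : ∀ x y → used x ≡ 0 → used y ≡ 0 → x ≡ y
  used-unique x y ux uy with x Fin.≟ y
  ... | yes x≡y = x≡y
  ... | no  x≢y = contradiction (avoid-colour G c proper x absent) (minimal k ≤-refl)
    where
    c′≡f : ∀ v → v ∈ S → transpose x y (c v) ≡ f v
    c′≡f v v∈S rewrite c≡f v v∈S = transpose-other (unused ux v v∈S) (unused uy v v∈S)
    c≡c′ : ∀ v → c v ≡ transpose x y (c v)
    c≡c′ = unique c (transpose x y ∘ c) proper (λ u v uv eq → proper u v uv (transpose-injective x y eq)) c≡f c′≡f
    -- The colouring is invariant under the exchange, so a vertex of colour `x` would have colour
    -- `y` as well.
    absent : ∀ v → x ≢ c v
    absent v x≡cv = x≢y (trans x≡cv (trans (c≡c′ v) (trans (cong (transpose x y) (sym x≡cv)) (transpose-left x y))))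

-- Necessary conditions on the parameters

-- The degree in the reflexive closure of the complement: `v` counts itself because of `irrefl`.
codegree : ∀ {n} → Graph n → Fin n → ℕ
codegree G v = sum (λ u → ⟦ not (adj G v u) ⟧)

degree+codegree : ∀ {n} (G : Graph n) v → degree G v + codegree G v ≡ n
degree+codegree G v = trans (cong (_+ codegree G v) (degree≡sum G v)) (sum-complement (adj G v))

codegree-positive : ∀ {n} (G : Graph n) v → 1 ≤ codegree G v
codegree-positive G v = subst (λ b → ⟦ not b ⟧ ≤ codegree G v) (irrefl G v) (term≤sum _ v)

handshake : ∀ {n r} (G : Graph n) → Regular r G → ∃[ m ] n * r ≡ m + m
handshake {n} {r} G regular
  with m , eq ← sum-symmetric-even (λ u v → ⟦ adj G u v ⟧) (λ u v → cong ⟦_⟧ (adj-sym G u v)) (λ v → cong ⟦_⟧ (irrefl G v))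
  = m , trans (sym (sum-const n r)) (trans (sum-cong-≗ (λ v → trans (sym (regular v)) (degree≡sum G v))) eq)

-- A colour class is independent, hence contained in the set counted by the codegree of any of its
-- members. So each of the `k` classes has at most `e` vertices.
colourable-bound : ∀ {n k e} (G : Graph n) → (∀ v → codegree G v ≡ e) → Colorable G k → n ≤ k * e
colourable-bound {n} {k} {e} G codeg≡e (c , proper) = begin
  n                       ≡⟨ *-identityʳ n ⟨
  n * 1                   ≡⟨ sum-const n 1 ⟨
  sum {n} (λ _ → 1)       ≡⟨ sum-fibres (λ _ → 1) c ⟩
  sum (λ x → class x)     ≤⟨ sum-mono class≤e ⟩
  sum {k} (λ _ → e)       ≡⟨ sum-const k e ⟩
  k * e                   ∎
  where
  open ≤-Reasoning
  class : Fin k → ℕ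
  class x = sum (λ v → 1 * ⟦ does (c v Fin.≟ x) ⟧)
  class≤codegree : ∀ u → class (c u) ≤ codegree G u
  class≤codegree u = sum-mono λ v → pointwise v
    where
    pointwise : ∀ v → 1 * ⟦ does (c v Fin.≟ c u) ⟧ ≤ ⟦ not (adj G u v) ⟧
    pointwise v with c v Fin.≟ c u | adj G u v in uv
    ... | no  _   | _     = z≤n
    ... | yes eq  | true  = contradiction (sym eq) (proper u v uv)
    ... | yes _   | false = ≤-refl
  class≤e : ∀ x → class x ≤ e
  class≤e x with Fin.any? (λ u → c u Fin.≟ x)
  ... | yes (u , refl) = ≤-trans (class≤codegree u) (≤-reflexive (codeg≡e u))
  ... | no  ∄u = begin
    class x              ≡⟨ sum-cong-≗ (λ v → cong (λ b → 1 * ⟦ b ⟧) (dec-false (c v Fin.≟ x) (∄u ∘ (v ,_)))) ⟩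
    sum {n} (λ _ → 0)    ≡⟨ sum-replicate-zero n ⟩
    0                    ≤⟨ z≤n ⟩
    e                    ∎

-- M, P, Q, T are the blocks (A–B, A–C, B–C and C–C) of the reflexive closure
-- of the complement graph.
record Design (k f d : ℕ) : Set where
  field
    M : Fin k → Fin k → Bool
    P Q : Fin k → Fin f → Bool
    T : Fin f → Fin f → Bool
    T-sym : ∀ s t → T s t ≡ T t s
    row-a : ∀ i → sum (λ j → ⟦ M i j ⟧) + sum (λ s → ⟦ P i s ⟧) ≡ d
    row-b : ∀ j → sum (λ i → ⟦ M i j ⟧) + sum (λ s → ⟦ Q j s ⟧) ≡ d
    row-c : ∀ s → sum (λ i → ⟦ P i s ⟧) + (sum (λ j → ⟦ Q j s ⟧) + sum (λ t → ⟦ T s t ⟧)) ≡ suc d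
    φ : Fin f → Fin k
    M-diag : ∀ i → M i i ≡ true
    P-φ : ∀ s → P (φ s) s ≡ true
    Q-φ : ∀ s → Q (φ s) s ≡ true
    T-φ : ∀ s t → φ s ≡ φ t → T s t ≡ true
    φ-unique : ∀ i s → P i s ≡ true → Q i s ≡ true → i ≡ φ s
    cut : ℕ
    cut>0 : 0 < cut
    M-low : ∀ i j → M i j ≡ true → toℕ i < cut → toℕ j < cut → toℕ i ≤ toℕ j
    M-high : ∀ i j → M i j ≡ true → cut ≤ toℕ i → cut ≤ toℕ j → toℕ i ≤ toℕ j
    M-zero : ∀ i j → M i j ≡ true → toℕ i ≡ 0 → toℕ j < cut

-- The graph of a design and the uniqueness of its extension

injective⇒surjective : ∀ {k} (g : Fin k → Fin k) → (∀ i j → g i ≡ g j → i ≡ j) → ∀ x → ∃[ i ] g i ≡ x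
injective⇒surjective {suc k} g g-inj x with Fin.any? (λ i → g i Fin.≟ x)
... | yes found = found
... | no  ∄i =
  let i , j , i<j , eq = Fin.pigeonhole ≤-refl (λ i → punchOut (x≢g i))
  in contradiction (g-inj i j (Fin.punchOut-injective (x≢g i) (x≢g j) eq)) (Fin.<⇒≢ i<j)
  where
  x≢g : ∀ i → x ≢ g i
  x≢g i x≡gi = ∄i (i , sym x≡gi)

does-≟-sym : ∀ {n} (i j : Fin n) → does (i Fin.≟ j) ≡ does (j Fin.≟ i)
does-≟-sym i j = does-⇔ (mk⇔ sym sym) (i Fin.≟ j) (j Fin.≟ i)

module Realise {k f d : ℕ} (D : Design k f d) where
  open Design D

  data Vertex : Set where
    a b : Fin k → Vertex
    c   : Fin f → Vertex

  N : ℕ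
  N = k + (k + f)

  encode : Vertex → Fin N
  encode (a i) = i ↑ˡ (k + f)
  encode (b i) = k ↑ʳ (i ↑ˡ f)
  encode (c s) = k ↑ʳ (k ↑ʳ s)

  decode′ : Fin k ⊎ Fin (k + f) → Vertex
  decode″ : Fin k ⊎ Fin f → Vertex
  decode′ (inj₁ i) = a i
  decode′ (inj₂ x) = decode″ (splitAt k x)
  decode″ (inj₁ i) = b i
  decode″ (inj₂ s) = c s

  decode : Fin N → Vertex
  decode v = decode′ (splitAt k v)

  decode-encode : ∀ x → decode (encode x) ≡ x
  decode-encode (a i) rewrite Fin.splitAt-↑ˡ k i (k + f) = refl
  decode-encode (b i) rewrite Fin.splitAt-↑ʳ k (k + f) (i ↑ˡ f) | Fin.splitAt-↑ˡ k i f = refl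
  decode-encode (c s) rewrite Fin.splitAt-↑ʳ k (k + f) (k ↑ʳ s) | Fin.splitAt-↑ʳ k f s = refl

  encode-decode : ∀ v → encode (decode v) ≡ v
  encode-decode v with splitAt k v in eq
  ... | inj₁ i = Fin.splitAt⁻¹-↑ˡ eq
  ... | inj₂ x with splitAt k x in eq′
  ...   | inj₁ i = trans (cong (k ↑ʳ_) (Fin.splitAt⁻¹-↑ˡ eq′)) (Fin.splitAt⁻¹-↑ʳ eq)
  ...   | inj₂ s = trans (cong (k ↑ʳ_) (Fin.splitAt⁻¹-↑ʳ eq′)) (Fin.splitAt⁻¹-↑ʳ eq)

  sum-vertices : ∀ (g : Vertex → ℕ) → sum (g ∘ decode) ≡ sum (g ∘ a) + (sum (g ∘ b) + sum (g ∘ c))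
  sum-vertices g = trans (sum-↑ k (g ∘ decode)) (cong₂ _+_ (sum-cong-≗ (λ i → cong g (decode-encode (a i))))
    (trans (sum-↑ k (g ∘ decode ∘ (k ↑ʳ_))) (cong₂ _+_ (sum-cong-≗ (λ i → cong g (decode-encode (b i))))
                                                      (sum-cong-≗ (λ s → cong g (decode-encode (c s)))))))

  -- Equality or adjacency in the complement. Distinct a's are never near, so they form a clique of
  -- `graph`; the same holds for the b's.
  near : Vertex → Vertex → Bool
  near (a i) (a j) = does (i Fin.≟ j)
  near (a i) (b j) = M i j
  near (a i) (c s) = P i s
  near (b j) (a i) = M i j
  near (b i) (b j) = does (i Fin.≟ j)
  near (b j) (c s) = Q j s
  near (c s) (a i) = P i s
  near (c s) (b j) = Q j s
  near (c s) (c t) = T s t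

  near-sym : ∀ x y → near x y ≡ near y x
  near-sym (a i) (a j) = does-≟-sym i j
  near-sym (a i) (b j) = refl
  near-sym (a i) (c s) = refl
  near-sym (b j) (a i) = refl
  near-sym (b i) (b j) = does-≟-sym i j
  near-sym (b j) (c s) = refl
  near-sym (c s) (a i) = refl
  near-sym (c s) (b j) = refl
  near-sym (c s) (c t) = T-sym s t

  class : Vertex → Fin k
  class (a i) = i
  class (b i) = i
  class (c s) = φ s

  -- The intended colour classes are cliques of the complement. This gives both irreflexivity of
  -- `graph` and properness of the colouring.
  class⇒near : ∀ x y → class x ≡ class y → near x y ≡ true
  class⇒near (a i) (a j) eq   = dec-true (i Fin.≟ j) eq
  class⇒near (a i) (b _) refl = M-diag i
  class⇒near (a _) (c s) refl = P-φ s
  class⇒near (b i) (a _) refl = M-diag i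
  class⇒near (b i) (b j) eq   = dec-true (i Fin.≟ j) eq
  class⇒near (b _) (c s) refl = Q-φ s
  class⇒near (c s) (a _) refl = P-φ s
  class⇒near (c s) (b _) refl = Q-φ s
  class⇒near (c s) (c t) eq   = T-φ s t eq

  graph : Graph N
  graph = record
    { adj     = λ u v → not (near (decode u) (decode v))
    ; adj-sym = λ u v → cong not (near-sym (decode u) (decode v))
    ; irrefl  = λ v → cong not (class⇒near (decode v) (decode v) refl)
    }

  near-count : ∀ x → sum (λ v → ⟦ near x (decode v) ⟧) ≡ suc d
  near-count x = trans (sum-vertices (⟦_⟧ ∘ near x)) (count x)
    where
    count : ∀ x → sum (λ i → ⟦ near x (a i) ⟧) + (sum (λ i → ⟦ near x (b i) ⟧) + sum (λ s → ⟦ near x (c s) ⟧)) ≡ suc d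
    count (a i) = cong₂ _+_ (sum-indicator i) (row-a i)
    count (b j) = begin
      m + (sum (λ i → ⟦ does (j Fin.≟ i) ⟧) + y)  ≡⟨ cong (λ z → m + (z + y)) (sum-indicator j) ⟩
      m + suc y                                    ≡⟨ +-suc m y ⟩
      suc (m + y)                                  ≡⟨ cong suc (row-b j) ⟩
      suc d                                        ∎
      where
      open ≡-Reasoning
      m = sum (λ i → ⟦ M i j ⟧)
      y = sum (λ s → ⟦ Q j s ⟧)
    count (c s) = row-c s

  regular : ∀ {r} → r + suc d ≡ N → Regular r graph
  regular {r} r+d+1≡N v = +-cancelʳ-≡ (suc d) _ _ (begin
    degree graph v + suc d              ≡⟨ cong (degree graph v +_) (near-count (decode v)) ⟨
    degree graph v + sum (λ u → ⟦ near (decode v) (decode u) ⟧)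
      ≡⟨ cong (degree graph v +_) (sum-cong-≗ (λ u → cong ⟦_⟧ (not-involutive (near (decode v) (decode u))))) ⟨
    degree graph v + codegree graph v   ≡⟨ degree+codegree graph v ⟩
    N                                   ≡⟨ r+d+1≡N ⟨
    r + suc d                           ∎)
    where open ≡-Reasoning

  colouring : Fin N → Fin k
  colouring = class ∘ decode

  colouring-proper : Proper graph colouring
  colouring-proper u v uv eq with () ← trans (sym uv) (cong not (class⇒near (decode u) (decode v) eq))

  -- Vertices that are not near are adjacent in `graph`. All forcing arguments below use properness
  -- in this form.
  same-colour⇒near : ∀ {m} (col : Fin N → Fin m) → Proper graph col →
                     ∀ x y → col (encode x) ≡ col (encode y) → near x y ≡ true
  same-colour⇒near col proper x y eq with near x y in xy
  ... | true  = refl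
  ... | false = contradiction eq (proper (encode x) (encode y)
          (trans (cong₂ (λ x y → not (near x y)) (decode-encode x) (decode-encode y)) (cong not xy)))

  a-injective : ∀ {m} (col : Fin N → Fin m) → Proper graph col →
                ∀ i j → col (encode (a i)) ≡ col (encode (a j)) → i ≡ j
  a-injective col proper i j eq = holds (i Fin.≟ j) (same-colour⇒near col proper (a i) (a j) eq)

  -- The lower bound comes from the clique formed by the `k` a's.
  chromatic : ChromaticNumber graph k
  chromatic = (colouring , colouring-proper) , λ m m<k (col , proper) →
    let i , j , i<j , eq = Fin.pigeonhole m<k (col ∘ encode ∘ a)
    in Fin.<⇒≢ i<j (a-injective col proper i j eq)

  chosen : Vertex → Bool
  chosen (a i) = does (0 <? toℕ i) ∧ does (toℕ i <? cut)
  chosen (b i) = does (cut ≤? toℕ i)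
  chosen (c s) = false

  S : Subset N
  S = Vec.tabulate (chosen ∘ decode)

  S-size : ∣ S ∣ ≡ k ∸ 1
  S-size = begin
    ∣ S ∣                                            ≡⟨ ∣∣≡sum S ⟩
    sum (λ v → ⟦ Vec.lookup S v ⟧)                   ≡⟨ sum-cong-≗ (λ v → cong ⟦_⟧ (Vec.lookup∘tabulate (chosen ∘ decode) v)) ⟩
    sum (⟦_⟧ ∘ chosen ∘ decode)                      ≡⟨ sum-vertices (⟦_⟧ ∘ chosen) ⟩
    A + (B + sum {f} (λ _ → 0))                      ≡⟨ cong (λ z → A + (B + z)) (sum-replicate-zero f) ⟩
    A + (B + 0)                                      ≡⟨ cong (A +_) (+-identityʳ B) ⟩
    A + B                                            ≡⟨ ∑-distrib-+ (⟦_⟧ ∘ chosen ∘ a) (⟦_⟧ ∘ chosen ∘ b) ⟨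
    sum (λ i → ⟦ chosen (a i) ⟧ + ⟦ chosen (b i) ⟧)  ≡⟨ sum-cong-≗ one-per-class ⟩
    sum {k} (λ i → ⟦ does (0 <? toℕ i) ⟧)            ≡⟨ all-but-zero k ⟩
    k ∸ 1                                            ∎
    where
    open ≡-Reasoning
    A = sum (⟦_⟧ ∘ chosen ∘ a)
    B = sum (⟦_⟧ ∘ chosen ∘ b)
    -- Class 0 contributes nothing: its a is excluded explicitly and its b by `cut>0`. Every other
    -- class contributes its a or its b, according to its side of the cut.
    one-per-class : ∀ i → ⟦ chosen (a i) ⟧ + ⟦ chosen (b i) ⟧ ≡ ⟦ does (0 <? toℕ i) ⟧
    one-per-class i with toℕ i <? cut
    one-per-class zero    | yes _ = cong ⟦_⟧ (dec-false (cut ≤? 0) (<⇒≱ cut>0))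
    one-per-class (suc i) | yes i<cut rewrite dec-true (suc (toℕ i) <? cut) i<cut | dec-false (cut ≤? suc (toℕ i)) (<⇒≱ i<cut) = refl
    one-per-class zero    | no i≮cut = contradiction cut>0 i≮cut
    one-per-class (suc i) | no i≮cut rewrite dec-false (suc (toℕ i) <? cut) i≮cut | dec-true (cut ≤? suc (toℕ i)) (≮⇒≥ i≮cut) = refl
    all-but-zero : ∀ k → sum {k} (λ i → ⟦ does (0 <? toℕ i) ⟧) ≡ k ∸ 1
    all-but-zero zero    = refl
    all-but-zero (suc k) = trans (sum-const k 1) (*-identityʳ k)

  -- Colours are forced in this order: the a's beyond the cut by increasing index, then `a₀`, then
  -- the b's below the cut by increasing index, and finally the c's.
  module Unique (col : Fin N → Fin k) (proper : Proper graph col)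
                (agree : ∀ v → v ∈ S → col v ≡ colouring v) where

    Fixed : Vertex → Set
    Fixed x = col (encode x) ≡ class x

    same⇒near : ∀ x y {z} → col (encode x) ≡ z → col (encode y) ≡ z → near x y ≡ true
    same⇒near x y p q = same-colour⇒near col proper x y (trans p (sym q))

    fixed-chosen : ∀ x → chosen x ≡ true → Fixed x
    fixed-chosen x ch = trans (agree (encode x) x∈S) (cong class (decode-encode x))
      where
      x∈S : encode x ∈ S
      x∈S = Vec.lookup⇒[]= (encode x) S
        (trans (Vec.lookup∘tabulate (chosen ∘ decode) (encode x)) (trans (cong chosen (decode-encode x)) ch))

    fixed-a-low : ∀ i → 0 < toℕ i → toℕ i < cut → Fixed (a i)
    fixed-a-low i 0<i i<cut = fixed-chosen (a i)
      (cong₂ _∧_ (dec-true (0 <? toℕ i) 0<i) (dec-true (toℕ i <? cut) i<cut))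

    fixed-b-high : ∀ i → cut ≤ toℕ i → Fixed (b i)
    fixed-b-high i cut≤i = fixed-chosen (b i) (dec-true (cut ≤? toℕ i) cut≤i)

    -- The `k` a's use all `k` colours, so some `aⱼ` has colour `i`, like the chosen `bᵢ`, and the
    -- two are near. Index `j` is not below the cut: `M-zero` excludes 0, and the other low a's have
    -- low colours. Then `M-high` gives `j ≤ i`, and `j < i` would contradict the induction
    -- hypothesis.
    fixed-a-high : ∀ i → cut ≤ toℕ i → Fixed (a i)
    fixed-a-high i = <-rec (λ m → ∀ i → toℕ i ≡ m → cut ≤ toℕ i → Fixed (a i)) step (toℕ i) i refl
      where
      step : ∀ m → (∀ {m′} → m′ < m → ∀ i → toℕ i ≡ m′ → cut ≤ toℕ i → Fixed (a i)) →
             ∀ i → toℕ i ≡ m → cut ≤ toℕ i → Fixed (a i)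
      step _ rec i refl cut≤i = subst (λ j → col (encode (a j)) ≡ i) j≡i j-coloured
        where
        owner : ∃[ j ] col (encode (a j)) ≡ i
        owner = injective⇒surjective (col ∘ encode ∘ a) (a-injective col proper) i
        j = proj₁ owner
        j-coloured = proj₂ owner
        Mji : M j i ≡ true
        Mji = same⇒near (a j) (b i) j-coloured (fixed-b-high i cut≤i)
        cut≤j : cut ≤ toℕ j
        cut≤j = ≮⇒≥ case-low
          where
          case-low : ¬ (toℕ j < cut)
          case-low j<cut with 0 <? toℕ j
          ... | no  0≮j = <⇒≱ (M-zero j i Mji (n≤0⇒n≡0 (≮⇒≥ 0≮j))) cut≤i
          ... | yes 0<j = <⇒≱ (subst (λ z → toℕ z < cut) (trans (sym (fixed-a-low j 0<j j<cut)) j-coloured) j<cut) cut≤i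
        j≡i : j ≡ i
        j≡i with m≤n⇒m<n∨m≡n (M-high j i Mji cut≤j cut≤i)
        ... | inj₁ j<i = trans (sym (rec j<i j refl cut≤j)) j-coloured
        ... | inj₂ eq  = Fin.toℕ-injective eq

    fixed-a-nonzero : ∀ i → 0 < toℕ i → Fixed (a i)
    fixed-a-nonzero i 0<i with toℕ i <? cut
    ... | yes i<cut = fixed-a-low i 0<i i<cut
    ... | no  i≮cut = fixed-a-high i (≮⇒≥ i≮cut)

    -- The other a's occupy all nonzero colours, which leaves 0 for `a₀`.
    fixed-a : ∀ i → Fixed (a i)
    fixed-a i with 0 <? toℕ i
    ... | yes 0<i = fixed-a-nonzero i 0<i
    ... | no  0≮i with 0 <? toℕ (col (encode (a i)))
    ...   | yes 0<y = sym (a-injective col proper i _ (sym (fixed-a-nonzero _ 0<y)))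
    ...   | no  0≮y = Fin.toℕ-injective (trans (n≤0⇒n≡0 (≮⇒≥ 0≮y)) (sym (n≤0⇒n≡0 (≮⇒≥ 0≮i))))

    b-injective : ∀ i j {z} → col (encode (b i)) ≡ z → col (encode (b j)) ≡ z → i ≡ j
    b-injective i j p q = holds (i Fin.≟ j) (same⇒near (b i) (b j) p q)

    -- Let `y` be the colour of `bᵢ`. If `y` is beyond the cut, `b_y` is chosen and already has it.
    -- Otherwise `a_y` has it too, so `M-low` gives `y ≤ i`, and for `y < i` the induction
    -- hypothesis says that `b_y` has it. As distinct b's have distinct colours, `y` is `i` in every
    -- case.
    fixed-b-low : ∀ i → toℕ i < cut → Fixed (b i)
    fixed-b-low i = <-rec (λ m → ∀ i → toℕ i ≡ m → toℕ i < cut → Fixed (b i)) step (toℕ i) i refl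
      where
      step : ∀ m → (∀ {m′} → m′ < m → ∀ i → toℕ i ≡ m′ → toℕ i < cut → Fixed (b i)) →
             ∀ i → toℕ i ≡ m → toℕ i < cut → Fixed (b i)
      step _ rec i refl i<cut with toℕ (col (encode (b i))) <? cut
      ... | no  y≮cut = sym (b-injective i _ refl (fixed-b-high _ (≮⇒≥ y≮cut)))
      ... | yes y<cut with m≤n⇒m<n∨m≡n (M-low _ i (same⇒near (a _) (b i) (fixed-a _) refl) y<cut i<cut)
      ...   | inj₁ y<i = sym (b-injective i _ refl (rec y<i _ refl y<cut))
      ...   | inj₂ eq  = Fin.toℕ-injective eq

    fixed : ∀ x → Fixed x
    fixed (a i) = fixed-a i
    fixed (b i) with toℕ i <? cut
    ... | yes i<cut = fixed-b-low i i<cut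
    ... | no  i≮cut = fixed-b-high i (≮⇒≥ i≮cut)
    -- The vertices `a_y` and `b_y` share the colour `y` of this c, so both are near it, and
    -- `φ-unique` identifies `y`.
    fixed (c s) = φ-unique _ s (same⇒near (a y) (c s) (fixed (a y)) refl) (same⇒near (b y) (c s) (fixed (b y)) refl)
      where y = col (encode (c s))

    col≡colouring : ∀ v → col v ≡ colouring v
    col≡colouring v = trans (cong col (sym (encode-decode v))) (fixed (decode v))

  definingSet : HasDefiningSetOfSize graph k (k ∸ 1)
  definingSet = S , colouring ,
    ( (colouring , colouring-proper , λ _ _ → refl)
    , λ col col′ p p′ e e′ v → trans (Unique.col≡colouring col p e v) (sym (Unique.col≡colouring col′ p′ e′ v)) )
    , S-size

design⇒DefNum : ∀ {k f d r} → Design k f d → r + suc d ≡ k + (k + f) → DefNum (k + (k + f)) r k (k ∸ 1)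
design⇒DefNum D eq =
  (graph , (regular eq , chromatic) , definingSet , definingSet-bound graph chromatic) ,
  λ G (_ , χ≡k) m (has , _) → definingSet-bound G χ≡k m has
  where open Realise D

-- Sums over initial segments of ℕ

∑< : ℕ → (ℕ → ℕ) → ℕ
∑< n g = sum {n} (g ∘ toℕ)

∑<-cong : ∀ n {g g′ : ℕ → ℕ} → (∀ i → i < n → g i ≡ g′ i) → ∑< n g ≡ ∑< n g′
∑<-cong n g≡g′ = sum-cong-≗ (λ i → g≡g′ (toℕ i) (Fin.toℕ<n i))

∑<-zero : ∀ n {g : ℕ → ℕ} → (∀ i → i < n → g i ≡ 0) → ∑< n g ≡ 0
∑<-zero n g≡0 = trans (∑<-cong n g≡0) (sum-replicate-zero n)

∑<-split : ∀ m n g → ∑< (m + n) g ≡ ∑< m g + ∑< n (λ i → g (m + i))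
∑<-split zero    n g = refl
∑<-split (suc m) n g = trans (cong (g 0 +_) (∑<-split m n (g ∘ suc))) (sym (+-assoc (g 0) _ _))

∑<-last : ∀ n g → ∑< (suc n) g ≡ ∑< n g + g n
∑<-last zero    g = +-identityʳ (g 0)
∑<-last (suc n) g = trans (cong (g 0 +_) (∑<-last n (g ∘ suc))) (sym (+-assoc (g 0) _ _))

∑<-reverse : ∀ n g → ∑< n (λ i → g (n ∸ suc i)) ≡ ∑< n g
∑<-reverse zero    g = refl
∑<-reverse (suc n) g = begin
  g n + ∑< n (λ i → g (n ∸ suc i))   ≡⟨ cong (g n +_) (∑<-reverse n g) ⟩
  g n + ∑< n g                       ≡⟨ +-comm (g n) _ ⟩
  ∑< n g + g n                       ≡⟨ ∑<-last n g ⟨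
  ∑< (suc n) g                       ∎
  where open ≡-Reasoning

∑<-prefix : ∀ {h k} (g : ℕ → ℕ) → h ≤ k → ∑< k (λ x → g x * ⟦ does (x <? h) ⟧) ≡ ∑< h g
∑<-prefix {h} {k} g h≤k = begin
  ∑< k w                                ≡⟨ cong (λ k → ∑< k w) (m+[n∸m]≡n h≤k) ⟨
  ∑< (h + (k ∸ h)) w                    ≡⟨ ∑<-split h (k ∸ h) w ⟩
  ∑< h w + ∑< (k ∸ h) (w ∘ (h +_))      ≡⟨ cong₂ _+_ (∑<-cong h inner) (∑<-zero (k ∸ h) outer) ⟩
  ∑< h g + 0                            ≡⟨ +-identityʳ _ ⟩
  ∑< h g                                ∎
  where
  open ≡-Reasoning
  w : ℕ → ℕ
  w x = g x * ⟦ does (x <? h) ⟧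
  inner : ∀ x → x < h → w x ≡ g x
  inner x x<h = trans (cong (λ b → g x * ⟦ b ⟧) (dec-true (x <? h) x<h)) (*-identityʳ (g x))
  outer : ∀ x → x < k ∸ h → w (h + x) ≡ 0
  outer x _ = trans (cong (λ b → g (h + x) * ⟦ b ⟧) (dec-false (h + x <? h) (m+n≮m h x))) (*-zeroʳ (g (h + x)))

∑<-point : ∀ {m k} (g : ℕ → ℕ) → m < k → ∑< k (λ x → g x * ⟦ does (x ≟ m) ⟧) ≡ g m
∑<-point {zero}  {suc k} g _ =
  trans (cong₂ _+_ (*-identityʳ (g 0)) (∑<-zero k {λ x → g (suc x) * 0} (λ x _ → *-zeroʳ (g (suc x))))) (+-identityʳ (g 0))
∑<-point {suc m} {suc k} g (s<s m<k) =
  trans (cong (_+ ∑< k (λ x → g (suc x) * ⟦ does (x ≟ m) ⟧)) (*-zeroʳ (g 0))) (∑<-point (g ∘ suc) m<k)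

Periodic : ℕ → (ℕ → ℕ) → Set
Periodic k g = ∀ x → g (k + x) ≡ g x

-- A shift by one trades `g 0` for `g k`, which periodicity makes equal.
∑<-shift : ∀ {k g} → Periodic k g → ∀ s → ∑< k (λ x → g (s + x)) ≡ ∑< k g
∑<-shift         per zero    = refl
∑<-shift {k} {g} per (suc s) = trans (∑<-shift {g = g ∘ suc} per∘suc s) rotate
  where
  open ≡-Reasoning
  per∘suc : Periodic k (g ∘ suc)
  per∘suc x = trans (cong g (sym (+-suc k x))) (per (suc x))
  rotate : ∑< k (g ∘ suc) ≡ ∑< k g
  rotate = +-cancelˡ-≡ (g 0) _ _ (begin
    g 0 + ∑< k (g ∘ suc)   ≡⟨ ∑<-last k g ⟩
    ∑< k g + g k           ≡⟨ +-comm _ (g k) ⟩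
    g k + ∑< k g           ≡⟨ cong (λ z → g z + ∑< k g) (+-identityʳ k) ⟨
    g (k + 0) + ∑< k g     ≡⟨ cong (_+ ∑< k g) (per 0) ⟩
    g 0 + ∑< k g           ∎)

∑<-periods : ∀ e {k g} → Periodic k g → ∑< (e * k) g ≡ e * ∑< k g
∑<-periods zero            per = refl
∑<-periods (suc e) {k} {g} per = trans (∑<-split k (e * k) g) (cong (∑< k g +_)
  (trans (∑<-cong (e * k) (λ x _ → per x)) (∑<-periods e per)))

-- Differences modulo k

module Cyclic (k : ℕ) .{{_ : NonZero k}} where

  -- The residue of j - i for `i ≤ k`, with `k ∸ i` in the role of -i.
  δ : ℕ → ℕ → ℕ
  δ i j = (j + (k ∸ i)) % k

  δ-forward : ∀ {i j} → i ≤ j → j < k → δ i j ≡ j ∸ i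
  δ-forward {i} {j} i≤j j<k = begin
    (j + (k ∸ i)) % k       ≡⟨ cong (_% k) (+-∸-assoc j (≤-trans i≤j (<⇒≤ j<k))) ⟨
    (j + k ∸ i) % k         ≡⟨ cong (_% k) (+-∸-comm k i≤j) ⟩
    (j ∸ i + k) % k         ≡⟨ [m+n]%n≡m%n (j ∸ i) k ⟩
    (j ∸ i) % k             ≡⟨ m<n⇒m%n≡m (≤-<-trans (m∸n≤m j i) j<k) ⟩
    j ∸ i                   ∎
    where open ≡-Reasoning

  δ-backward : ∀ {i j} → j < i → i ≤ k → δ i j ≡ j + (k ∸ i)
  δ-backward {i} {j} j<i i≤k = m<n⇒m%n≡m (<-≤-trans (+-monoˡ-< (k ∸ i) j<i) (≤-reflexive (m+[n∸m]≡n i≤k)))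

  δ-self : ∀ {i} → i < k → δ i i ≡ 0
  δ-self {i} i<k = trans (δ-forward ≤-refl i<k) (n∸n≡0 i)

  -- The substitution j = i + x, which is a shift of a periodic summand.
  δ-row : ∀ g (w : ℕ → ℕ) {i} → Periodic k g → i ≤ k →
          ∑< k (λ j → g j * w (δ i j)) ≡ ∑< k (λ x → g (i + x) * w x)
  δ-row g w {i} per i≤k = begin
    ∑< k G                         ≡⟨ ∑<-shift G-per i ⟨
    ∑< k (λ x → G (i + x))         ≡⟨ ∑<-cong k (λ x x<k → cong (λ z → g (i + x) * w z) (δ≡ x x<k)) ⟩
    ∑< k (λ x → g (i + x) * w x)   ∎
    where
    open ≡-Reasoning
    G : ℕ → ℕ
    G j = g j * w (δ i j)
    swap₁ : ∀ k x y → k + x + y ≡ x + y + k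
    swap₁ = solve-∀
    swap₂ : ∀ i x y → i + x + y ≡ x + (i + y)
    swap₂ = solve-∀
    G-per : Periodic k G
    G-per j = cong₂ (λ y z → y * w z) (per j) (trans (cong (_% k) (swap₁ k j (k ∸ i))) ([m+n]%n≡m%n _ k))
    δ≡ : ∀ x → x < k → δ i (i + x) ≡ x
    δ≡ x x<k = begin
      (i + x + (k ∸ i)) % k     ≡⟨ cong (_% k) (swap₂ i x (k ∸ i)) ⟩
      (x + (i + (k ∸ i))) % k   ≡⟨ cong (λ z → (x + z) % k) (m+[n∸m]≡n i≤k) ⟩
      (x + k) % k               ≡⟨ [m+n]%n≡m%n x k ⟩
      x % k                     ≡⟨ m<n⇒m%n≡m x<k ⟩
      x                         ∎

  -- The substitution i = j - x modulo `k`, carried out as a shift by `suc j` and a reversal;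
  -- `suc j + (k ∸ suc x)` represents j - x.
  δ-col : ∀ g (w : ℕ → ℕ) {j} → Periodic k g → j < k →
          ∑< k (λ i → g i * w (δ i j)) ≡ ∑< k (λ x → g (suc j + (k ∸ suc x)) * w x)
  δ-col g w {j} per j<k = begin
    ∑< k (λ i → g i * w (δ i j))               ≡⟨ ∑<-cong k (λ i i<k → cong (λ z → g i * w (δ z j)) (sym (m<n⇒m%n≡m i<k))) ⟩
    ∑< k G                                     ≡⟨ ∑<-shift G-per (suc j) ⟨
    ∑< k (λ x → G (suc j + x))                 ≡⟨ ∑<-reverse k (λ x → G (suc j + x)) ⟨
    ∑< k (λ x → G (suc j + (k ∸ suc x)))       ≡⟨ ∑<-cong k (λ x x<k → cong (λ z → g (suc j + (k ∸ suc x)) * w z) (δ≡ x x<k)) ⟩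
    ∑< k (λ x → g (suc j + (k ∸ suc x)) * w x) ∎
    where
    open ≡-Reasoning
    G : ℕ → ℕ
    -- The first argument of `δ` is meaningful only up to `k`, so it is reduced to make `G`
    -- periodic.
    G i = g i * w (δ (i % k) j)
    k+ : ∀ x → (k + x) % k ≡ x % k
    k+ x = trans (cong (_% k) (+-comm k x)) ([m+n]%n≡m%n x k)
    G-per : Periodic k G
    G-per i = cong₂ (λ y z → y * w (δ z j)) (per i) (k+ i)
    δ≡ : ∀ x → x < k → δ ((suc j + (k ∸ suc x)) % k) j ≡ x
    δ≡ x x<k with x ≤? j
    ... | yes x≤j = begin
      δ ((suc j + (k ∸ suc x)) % k) j   ≡⟨ cong (λ z → δ z j) (δ-forward′) ⟩
      δ (j ∸ x) j                       ≡⟨ δ-forward (m∸n≤m j x) j<k ⟩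
      j ∸ (j ∸ x)                       ≡⟨ m∸[m∸n]≡n x≤j ⟩
      x                                 ∎
      where
      -- The residue to be computed is itself a difference, `δ (suc x) (suc j)`, by definition.
      δ-forward′ : δ (suc x) (suc j) ≡ j ∸ x
      δ-forward′ = begin
        (suc j + (k ∸ suc x)) % k       ≡⟨ cong (_% k) (+-∸-assoc (suc j) x<k) ⟨
        (suc j + k ∸ suc x) % k         ≡⟨ cong (_% k) (+-∸-comm k x≤j) ⟩
        (j ∸ x + k) % k                 ≡⟨ [m+n]%n≡m%n (j ∸ x) k ⟩
        (j ∸ x) % k                     ≡⟨ m<n⇒m%n≡m (≤-<-trans (m∸n≤m j x) j<k) ⟩
        j ∸ x                           ∎
    ... | no x≰j = begin
      δ ((suc j + (k ∸ suc x)) % k) j   ≡⟨ cong (λ z → δ z j) (δ-backward (s<s j<x) x<k) ⟩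
      δ y j                             ≡⟨ δ-backward (s≤s (m≤m+n j (k ∸ suc x))) (m+n≤o⇒m≤o y (≤-reflexive y+[x∸j]≡k)) ⟩
      j + (k ∸ y)                       ≡⟨ cong (λ z → j + (z ∸ y)) y+[x∸j]≡k ⟨
      j + (y + (x ∸ j) ∸ y)             ≡⟨ cong (j +_) (m+n∸m≡n y _) ⟩
      j + (x ∸ j)                       ≡⟨ m+[n∸m]≡n (<⇒≤ j<x) ⟩
      x                                 ∎
      where
      j<x = ≰⇒> x≰j
      y = suc j + (k ∸ suc x)
      swap : ∀ j z w → suc j + z + w ≡ suc (j + w) + z
      swap = solve-∀
      y+[x∸j]≡k : y + (x ∸ j) ≡ k
      y+[x∸j]≡k = begin
        suc j + (k ∸ suc x) + (x ∸ j)     ≡⟨ swap j (k ∸ suc x) (x ∸ j) ⟩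
        suc (j + (x ∸ j)) + (k ∸ suc x)   ≡⟨ cong (λ z → suc z + (k ∸ suc x)) (m+[n∸m]≡n (<⇒≤ j<x)) ⟩
        suc x + (k ∸ suc x)               ≡⟨ m+[n∸m]≡n x<k ⟩
        k                                 ∎

  δ-row-window : ∀ {w i} → w ≤ k → i ≤ k → ∑< k (λ j → ⟦ does (δ i j <? w) ⟧) ≡ w
  δ-row-window {w} {i} w≤k i≤k = begin
    ∑< k (λ j → ⟦ does (δ i j <? w) ⟧)        ≡⟨ ∑<-cong k (λ j _ → *-identityˡ ⟦ does (δ i j <? w) ⟧) ⟨
    ∑< k (λ j → 1 * ⟦ does (δ i j <? w) ⟧)    ≡⟨ δ-row (λ _ → 1) (λ x → ⟦ does (x <? w) ⟧) (λ _ → refl) i≤k ⟩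
    ∑< k (λ x → 1 * ⟦ does (x <? w) ⟧)        ≡⟨ ∑<-prefix (λ _ → 1) w≤k ⟩
    ∑< w (λ _ → 1)                            ≡⟨ trans (sum-const w 1) (*-identityʳ w) ⟩
    w                                         ∎
    where open ≡-Reasoning

  δ-col-window : ∀ {w j} → w ≤ k → j < k → ∑< k (λ i → ⟦ does (δ i j <? w) ⟧) ≡ w
  δ-col-window {w} {j} w≤k j<k = begin
    ∑< k (λ i → ⟦ does (δ i j <? w) ⟧)        ≡⟨ ∑<-cong k (λ i _ → *-identityˡ ⟦ does (δ i j <? w) ⟧) ⟨
    ∑< k (λ i → 1 * ⟦ does (δ i j <? w) ⟧)    ≡⟨ δ-col (λ _ → 1) (λ x → ⟦ does (x <? w) ⟧) (λ _ → refl) j<k ⟩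
    ∑< k (λ x → 1 * ⟦ does (x <? w) ⟧)        ≡⟨ ∑<-prefix (λ _ → 1) w≤k ⟩
    ∑< w (λ _ → 1)                            ≡⟨ trans (sum-const w 1) (*-identityʳ w) ⟩
    w                                         ∎
    where open ≡-Reasoning

  -- A circulant band of width w has no entry below the diagonal within a block of
  -- consecutive indices of length at most k − w + 1.
  δ-triangular : ∀ {w i j o} → i < k → δ i j < w → o ≤ j → i + w ≤ k + o → i ≤ j
  δ-triangular {w} {i} {j} {o} i<k δ<w o≤j i+w≤k+o with i ≤? j
  ... | yes i≤j = i≤j
  ... | no  i≰j = contradiction bound (<⇒≱ δ<w)
    where
    open ≤-Reasoning
    bound : w ≤ δ i j
    bound = +-cancelˡ-≤ i w (δ i j) (begin
      i + w               ≤⟨ i+w≤k+o ⟩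
      k + o               ≤⟨ +-monoʳ-≤ k o≤j ⟩
      k + j               ≡⟨ cong (_+ j) (m+[n∸m]≡n (<⇒≤ i<k)) ⟨
      i + (k ∸ i) + j     ≡⟨ +-assoc i (k ∸ i) j ⟩
      i + (k ∸ i + j)     ≡⟨ cong (i +_) (+-comm (k ∸ i) j) ⟩
      i + (j + (k ∸ i))   ≡⟨ cong (i +_) (δ-backward (≰⇒> i≰j) (<⇒≤ i<k)) ⟨
      i + δ i j           ∎)

-- The complement is q copies of the complete graph on e + 2 vertices together with a bipartite circulant graph.
module Cliques (q p e : ℕ) .{{_ : NonZero q}} .{{_ : NonZero p}} (0<e : 0 < e) (2e≤p : e + e ≤ p) where
  open Cyclic p

  -- Each of the first `q` classes has an a, a b and the `e` c's of one residue modulo `q`, and is a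
  -- clique component of the complement. The other `p` classes have only an a and a b and carry a
  -- circulant band of width e + 1.
  Index : Set
  Index = Fin q ⊎ Fin p

  1+e≤p : suc e ≤ p
  1+e≤p = ≤-trans (+-monoˡ-≤ e 0<e) 2e≤p

  M₀ : Index → Index → Bool
  M₀ (inj₁ i) (inj₁ j) = does (i Fin.≟ j)
  M₀ (inj₁ i) (inj₂ j) = false
  M₀ (inj₂ i) (inj₁ j) = false
  M₀ (inj₂ i) (inj₂ j) = does (δ (toℕ i) (toℕ j) <? suc e)

  P₀ : Index → ℕ → Bool
  P₀ (inj₁ i) s = does (s % q ≟ toℕ i)
  P₀ (inj₂ i) s = false

  sum-index : ∀ (g : Index → ℕ) → sum (g ∘ splitAt q) ≡ sum (g ∘ inj₁) + sum (g ∘ inj₂)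
  sum-index g = trans (sum-↑ q (g ∘ splitAt q)) (cong₂ _+_
    (sum-cong-≗ (λ i → cong g (Fin.splitAt-↑ˡ q i p))) (sum-cong-≗ (λ i → cong g (Fin.splitAt-↑ʳ q p i))))

  does-≟-comm : ∀ m n → does (m ≟ n) ≡ does (n ≟ m)
  does-≟-comm m n = does-⇔ (mk⇔ sym sym) (m ≟ n) (n ≟ m)

  residue-count : ∀ {x} → x < q → ∑< (e * q) (λ s → ⟦ does (s % q ≟ x) ⟧) ≡ e
  residue-count {x} x<q = begin
    ∑< (e * q) (λ s → ⟦ does (s % q ≟ x) ⟧)   ≡⟨ ∑<-periods e (λ s → cong (λ z → ⟦ does (z ≟ x) ⟧) (trans (cong (_% q) (+-comm q s)) ([m+n]%n≡m%n s q))) ⟩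
    e * ∑< q (λ s → ⟦ does (s % q ≟ x) ⟧)     ≡⟨ cong (e *_) (∑<-cong q (λ s s<q → trans (cong (λ z → ⟦ does (z ≟ x) ⟧) (m<n⇒m%n≡m s<q)) (sym (*-identityˡ _)))) ⟩
    e * ∑< q (λ s → 1 * ⟦ does (s ≟ x) ⟧)     ≡⟨ cong (e *_) (∑<-point (λ _ → 1) x<q) ⟩
    e * 1                                     ≡⟨ *-identityʳ e ⟩
    e                                         ∎
    where open ≡-Reasoning

  row-a₀ : ∀ x → sum (λ j → ⟦ M₀ x (splitAt q j) ⟧) + ∑< (e * q) (λ s → ⟦ P₀ x s ⟧) ≡ suc e
  row-a₀ x = trans (cong (_+ ∑< (e * q) (λ s → ⟦ P₀ x s ⟧)) (sum-index (λ y → ⟦ M₀ x y ⟧))) (count x)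
    where
    count : ∀ x → sum (λ j → ⟦ M₀ x (inj₁ j) ⟧) + sum (λ j → ⟦ M₀ x (inj₂ j) ⟧) + ∑< (e * q) (λ s → ⟦ P₀ x s ⟧) ≡ suc e
    count (inj₁ i) = cong₂ _+_ (cong₂ _+_ (sum-indicator i) (sum-replicate-zero p)) (residue-count (Fin.toℕ<n i))
    count (inj₂ i) = trans (cong₂ _+_ (cong₂ _+_ (sum-replicate-zero q) (δ-row-window 1+e≤p (<⇒≤ (Fin.toℕ<n i)))) (sum-replicate-zero (e * q))) (+-identityʳ (suc e))

  row-b₀ : ∀ y → sum (λ i → ⟦ M₀ (splitAt q i) y ⟧) + ∑< (e * q) (λ s → ⟦ P₀ y s ⟧) ≡ suc e
  row-b₀ y = trans (cong (_+ ∑< (e * q) (λ s → ⟦ P₀ y s ⟧)) (sum-index (λ x → ⟦ M₀ x y ⟧))) (count y)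
    where
    indicatorʳ : ∀ (j : Fin q) → sum (λ i → ⟦ does (i Fin.≟ j) ⟧) ≡ 1
    indicatorʳ j = trans (sum-cong-≗ (λ i → cong ⟦_⟧ (does-≟-sym i j))) (sum-indicator j)
    count : ∀ y → sum (λ i → ⟦ M₀ (inj₁ i) y ⟧) + sum (λ i → ⟦ M₀ (inj₂ i) y ⟧) + ∑< (e * q) (λ s → ⟦ P₀ y s ⟧) ≡ suc e
    count (inj₁ j) = cong₂ _+_ (cong₂ _+_ (indicatorʳ j) (sum-replicate-zero p)) (residue-count (Fin.toℕ<n j))
    count (inj₂ j) = trans (cong₂ _+_ (cong₂ _+_ (sum-replicate-zero q) (δ-col-window 1+e≤p (Fin.toℕ<n j))) (sum-replicate-zero (e * q))) (+-identityʳ (suc e))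

  P-col : ∀ s → sum (λ i → ⟦ P₀ (splitAt q i) s ⟧) ≡ 1
  P-col s = begin
    sum (λ i → ⟦ P₀ (splitAt q i) s ⟧)                        ≡⟨ sum-index (λ x → ⟦ P₀ x s ⟧) ⟩
    ∑< q (λ i → ⟦ does (s % q ≟ i) ⟧) + sum {p} (λ _ → 0)     ≡⟨ cong₂ _+_ (∑<-cong q (λ i _ → trans (cong ⟦_⟧ (does-≟-comm (s % q) i)) (sym (*-identityˡ _)))) (sum-replicate-zero p) ⟩
    ∑< q (λ i → 1 * ⟦ does (i ≟ s % q) ⟧) + 0                 ≡⟨ +-identityʳ _ ⟩
    ∑< q (λ i → 1 * ⟦ does (i ≟ s % q) ⟧)                     ≡⟨ ∑<-point (λ _ → 1) (m%n<n s q) ⟩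
    1                                                         ∎
    where open ≡-Reasoning

  residue : ℕ → Fin q
  residue s = fromℕ< (m%n<n s q)

  toℕ-residue : ∀ s → toℕ (residue s) ≡ s % q
  toℕ-residue s = Fin.toℕ-fromℕ< (m%n<n s q)

  P₀-residue : ∀ s → P₀ (splitAt q (residue s ↑ˡ p)) s ≡ true
  P₀-residue s rewrite Fin.splitAt-↑ˡ q (residue s) p = dec-true (s % q ≟ toℕ (residue s)) (sym (toℕ-residue s))

  residue-unique : ∀ i s → P₀ (splitAt q i) s ≡ true → i ≡ residue s ↑ˡ p
  residue-unique i s Pis with splitAt q i in eq
  ... | inj₁ x = trans (sym (Fin.splitAt⁻¹-↑ˡ eq)) (cong (_↑ˡ p)
                   (Fin.toℕ-injective (trans (sym (holds (s % q ≟ toℕ x) Pis)) (sym (toℕ-residue s)))))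

  residue-eq : ∀ s t → residue s ↑ˡ p ≡ residue t ↑ˡ p → s % q ≡ t % q
  residue-eq s t eq = trans (sym (toℕ-residue s)) (trans (cong toℕ (Fin.↑ˡ-injective p _ _ eq)) (toℕ-residue t))

  M₀-diag : ∀ x → M₀ x x ≡ true
  M₀-diag (inj₁ i) = dec-true (i Fin.≟ i) refl
  M₀-diag (inj₂ i) = dec-true (δ (toℕ i) (toℕ i) <? suc e) (subst (_< suc e) (sym (δ-self (Fin.toℕ<n i))) z<s)

  position : Index → ℕ
  position (inj₁ i) = toℕ i
  position (inj₂ i) = q + toℕ i

  position-split : ∀ i → position (splitAt q i) ≡ toℕ i
  position-split i with splitAt q i in eq
  ... | inj₁ x = trans (sym (Fin.toℕ-↑ˡ x p)) (cong toℕ (Fin.splitAt⁻¹-↑ˡ eq))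
  ... | inj₂ x = trans (sym (Fin.toℕ-↑ʳ q x)) (cong toℕ (Fin.splitAt⁻¹-↑ʳ eq))

  -- Cliques join only equal indices here. The circulant has `e` indices below the cut, and 2e ≤ p
  -- keeps a band of width e + 1 from wrapping around within them.
  low : ∀ x y → M₀ x y ≡ true → position x < q + e → position y < q + e → position x ≤ position y
  low (inj₁ i) (inj₁ j) Mij _ _ = ≤-reflexive (cong toℕ (holds (i Fin.≟ j) Mij))
  low (inj₂ i) (inj₂ j) Mij i<e _ = +-monoʳ-≤ q (δ-triangular {o = 0} (Fin.toℕ<n i) (holds (_ <? suc e) Mij) z≤n (begin
    toℕ i + suc e   ≡⟨ +-suc (toℕ i) e ⟩
    suc (toℕ i) + e ≤⟨ +-monoˡ-≤ e (+-cancelˡ-< q _ _ i<e) ⟩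
    e + e           ≤⟨ 2e≤p ⟩
    p               ≡⟨ +-identityʳ p ⟨
    p + 0           ∎))
    where open ≤-Reasoning

  -- The circulant has p - e indices beyond the cut, exactly as many as a band of width e + 1
  -- allows.
  high : ∀ x y → M₀ x y ≡ true → q + e ≤ position x → q + e ≤ position y → position x ≤ position y
  high (inj₁ i) (inj₁ j) Mij _ _ = ≤-reflexive (cong toℕ (holds (i Fin.≟ j) Mij))
  high (inj₂ i) (inj₂ j) Mij _ e≤j = +-monoʳ-≤ q (δ-triangular {o = e} (Fin.toℕ<n i) (holds (_ <? suc e) Mij)
    (+-cancelˡ-≤ q _ _ e≤j) (≤-trans (≤-reflexive (+-suc (toℕ i) e)) (+-monoˡ-≤ e (Fin.toℕ<n i))))

  -- As `q` is positive, position 0 lies in a clique, whose a is near no b but its own.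
  zero-row : ∀ x y → M₀ x y ≡ true → position x ≡ 0 → position y < q + e
  zero-row (inj₁ i) (inj₁ j) Mij _ = ≤-trans (Fin.toℕ<n j) (m≤m+n q e)
  zero-row (inj₂ i) (inj₂ j) Mij q+i≡0 = contradiction (m+n≡0⇒m≡0 q q+i≡0) (≢-nonZero⁻¹ q)

  design : Design (q + p) (e * q) (suc e)
  design = record
    { M = λ i j → M₀ (splitAt q i) (splitAt q j)
    ; P = λ i s → P₀ (splitAt q i) (toℕ s)
    ; Q = λ i s → P₀ (splitAt q i) (toℕ s)
    ; T = λ s t → does (toℕ t % q ≟ toℕ s % q)
    ; T-sym = λ s t → does-≟-comm (toℕ t % q) (toℕ s % q)
    ; row-a = λ i → row-a₀ (splitAt q i)
    ; row-b = λ j → row-b₀ (splitAt q j)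
    -- One a, one b, and the `e` c's of the same residue, `s` included.
    ; row-c = λ s → cong₂ _+_ (P-col (toℕ s)) (cong₂ _+_ (P-col (toℕ s)) (residue-count (m%n<n (toℕ s) q)))
    ; φ = λ s → residue (toℕ s) ↑ˡ p
    ; M-diag = λ i → M₀-diag (splitAt q i)
    ; P-φ = λ s → P₀-residue (toℕ s)
    ; Q-φ = λ s → P₀-residue (toℕ s)
    ; T-φ = λ s t eq → dec-true (toℕ t % q ≟ toℕ s % q) (sym (residue-eq (toℕ s) (toℕ t) eq))
    ; φ-unique = λ i s Pis _ → residue-unique i (toℕ s) Pis
    ; cut = q + e
    ; cut>0 = ≤-trans 0<e (m≤n+m e q)
    ; M-low = λ i j Mij → subst₂ (λ x y → x < q + e → y < q + e → x ≤ y) (position-split i) (position-split j) (low (splitAt q i) (splitAt q j) Mij)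
    ; M-high = λ i j Mij → subst₂ (λ x y → q + e ≤ x → q + e ≤ y → x ≤ y) (position-split i) (position-split j) (high (splitAt q i) (splitAt q j) Mij)
    ; M-zero = λ i j Mij → subst₂ (λ x y → x ≡ 0 → y < q + e) (position-split i) (position-split j) (zero-row (splitAt q i) (splitAt q j) Mij)
    }

-- Cyclic distances, enumeration and carries

antipodal : ∀ k .{{_ : NonZero k}} {i j} → i < j → j < k → Cyclic.δ k i j + Cyclic.δ k j i ≡ k
antipodal k {i} {j} i<j j<k = begin
  δ i j + δ j i              ≡⟨ cong₂ _+_ (δ-forward (<⇒≤ i<j) j<k) (δ-backward i<j (<⇒≤ j<k)) ⟩
  (j ∸ i) + (i + (k ∸ j))    ≡⟨ +-assoc (j ∸ i) i (k ∸ j) ⟨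
  (j ∸ i) + i + (k ∸ j)      ≡⟨ cong (_+ (k ∸ j)) (m∸n+n≡m (<⇒≤ i<j)) ⟩
  j + (k ∸ j)                ≡⟨ m+[n∸m]≡n (<⇒≤ j<k) ⟩
  k                          ∎
  where
  open ≡-Reasoning
  open Cyclic k

-- The listing is specified by sums over it, for the degree counts, and by injectivity, which puts
-- the c's into distinct classes.
enumerate : ∀ {k f} (F : Fin k → Bool) → sum (⟦_⟧ ∘ F) ≡ f →
            Σ (Fin f → Fin k) λ τ → (∀ g → sum (g ∘ τ) ≡ sum (λ i → ⟦ F i ⟧ * g i)) × (∀ s t → τ s ≡ τ t → s ≡ t)
enumerate {zero}  F refl = (λ ()) , (λ g → refl) , λ ()
enumerate {suc k} F refl with F zero | enumerate (F ∘ suc) refl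
... | false | τ , τ-sum , τ-inj = suc ∘ τ , (λ g → τ-sum (g ∘ suc)) , λ s t eq → τ-inj s t (Fin.suc-injective eq)
... | true  | τ , τ-sum , τ-inj = τ′ , (λ g → cong₂ _+_ (sym (+-identityʳ (g zero))) (τ-sum (g ∘ suc))) , τ′-inj
  where
  τ′ : Fin _ → Fin _
  τ′ zero    = zero
  τ′ (suc s) = suc (τ s)
  τ′-inj : ∀ s t → τ′ s ≡ τ′ t → s ≡ t
  τ′-inj zero    zero    _  = refl
  τ′-inj zero    (suc t) ()
  τ′-inj (suc s) zero    ()
  τ′-inj (suc s) (suc t) eq = cong suc (τ-inj s t (Fin.suc-injective eq))

carry : ∀ k .{{_ : NonZero k}} → ℕ → ℕ → Bool
carry k x y = does (k ≤? x % k + y % k)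

-- As in column addition, two residues add up to less than 2k, so the quotient gains at most one
-- extra unit.
/-carry : ∀ k .{{_ : NonZero k}} x y → (x + y) / k ≡ x / k + y / k + ⟦ carry k x y ⟧
/-carry k x y with k ≤? x % k + y % k
... | no  k≰ rewrite dec-false (k ≤? x % k + y % k) k≰ = trans (+-distrib-/ x y (≰⇒> k≰)) (sym (+-identityʳ _))
... | yes k≤ rewrite dec-true (k ≤? x % k + y % k) k≤ = begin
  (x + y) / k                                   ≡⟨ cong (_/ k) x+y≡ ⟩
  (rest + suc (x / k + y / k) * k) / k          ≡⟨ +-distrib-/ rest (suc (x / k + y / k) * k) no-carry ⟩
  rest / k + suc (x / k + y / k) * k / k        ≡⟨ cong₂ _+_ (m<n⇒m/n≡0 rest<k) (m*n/n≡m (suc (x / k + y / k)) k) ⟩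
  suc (x / k + y / k)                           ≡⟨ +-comm 1 _ ⟩
  x / k + y / k + 1                             ∎
  where
  open ≡-Reasoning
  rest = x % k + y % k ∸ k
  rest<k : rest < k
  rest<k = +-cancelʳ-< k rest k (subst (_< k + k) (sym (m∸n+n≡m k≤)) (+-mono-< (m%n<n x k) (m%n<n y k)))
  no-carry : rest % k + suc (x / k + y / k) * k % k < k
  no-carry = subst (_< k) (sym (trans (cong (rest % k +_) (m*n%n≡0 (suc (x / k + y / k)) k)) (+-identityʳ _))) (m%n<n rest k)
  regroup : ∀ a b c d k → a + b * k + (c + d * k) ≡ (a + c) + (b + d) * k
  regroup = solve-∀
  x+y≡ : x + y ≡ rest + suc (x / k + y / k) * k
  x+y≡ = begin
    x + y                                           ≡⟨ cong₂ _+_ (m≡m%n+[m/n]*n x k) (m≡m%n+[m/n]*n y k) ⟩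
    x % k + x / k * k + (y % k + y / k * k)         ≡⟨ regroup (x % k) (x / k) (y % k) (y / k) k ⟩
    (x % k + y % k) + (x / k + y / k) * k           ≡⟨ cong (_+ (x / k + y / k) * k) (m∸n+n≡m k≤) ⟨
    rest + k + (x / k + y / k) * k                  ≡⟨ +-assoc rest k _ ⟩
    rest + suc (x / k + y / k) * k                  ∎

carry-periodic : ∀ k .{{_ : NonZero k}} f y x → carry k ((k + x) * f) y ≡ carry k (x * f) y
carry-periodic k f y x = cong (λ z → does (k ≤? z + y % k)) (trans (cong (_% k) (rearrange k x f)) ([m+kn]%n≡m%n (x * f) f k))
  where
  rearrange : ∀ k x f → (k + x) * f ≡ x * f + f * k
  rearrange = solve-∀

masked : ∀ x y r → (y ≡ true → x ≡ true) → ⟦ x ∧ not (r ∧ y) ⟧ + ⟦ r ⟧ * ⟦ y ⟧ ≡ ⟦ x ⟧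
masked true  false false _ = refl
masked true  false true  _ = refl
masked true  true  false _ = refl
masked true  true  true  _ = refl
masked false false false _ = refl
masked false false true  _ = refl
masked false true  r     y⇒x with () ← y⇒x refl

disjoint-∨ : ∀ x r y → (x ≡ true → r ≡ true → y ≡ false) → ⟦ x ∨ (r ∧ y) ⟧ ≡ ⟦ x ⟧ + ⟦ r ⟧ * ⟦ y ⟧
disjoint-∨ true  true  y excl rewrite excl refl refl = refl
disjoint-∨ true  false y excl = refl
disjoint-∨ false true  y excl = sym (*-identityˡ ⟦ y ⟧)
disjoint-∨ false false y excl = refl

⟦⟧≤1 : ∀ b → ⟦ b ⟧ ≤ 1
⟦⟧≤1 true  = ≤-refl
⟦⟧≤1 false = z≤n

-- N t counts the elements of F below t; R i says that the window of length h starting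
-- at i contains u + 1 elements of F rather than u.
module Balanced (k f g : ℕ) (ε : Bool) .{{_ : NonZero k}} (0<g : 0 < g)
                (enough : suc g + suc g + (⟦ ε ⟧ + ⟦ ε ⟧) ≤ f) (f<k : f < k)
                (even : ε ≡ true → ∀ m → suc (m + m) ≢ f) where
  open Cyclic k

  -- `e` is the parity of the degree `d` and `α` the width of the A-B band. Windows have length `h`,
  -- so `g` is the largest difference inside one.
  h e d u α : ℕ
  h = suc g
  e = ⟦ ε ⟧
  d = h + h + e
  u = (h * f) / k
  α = d ∸ u

  2h≤f : h + h ≤ f
  2h≤f = m+n≤o⇒m≤o (h + h) enough

  2h<k : h + h < k
  2h<k = ≤-<-trans 2h≤f f<k

  h<k : h < k
  h<k = ≤-<-trans (m≤m+n h h) 2h<k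

  u≤h : u ≤ h
  u≤h = begin
    (h * f) / k   ≤⟨ /-monoˡ-≤ k (*-monoʳ-≤ h (<⇒≤ f<k)) ⟩
    (h * k) / k   ≡⟨ m*n/n≡m h k ⟩
    h             ∎
    where open ≤-Reasoning

  α+u≡d : α + u ≡ d
  α+u≡d = m∸n+n≡m (≤-trans u≤h (≤-trans (m≤m+n h h) (m≤m+n (h + h) e)))

  -- This places the entry at difference `g`, the one that may be deleted, inside the band.
  h≤α : h ≤ α
  h≤α = +-cancelʳ-≤ u h α (begin
    h + u       ≤⟨ +-monoʳ-≤ h u≤h ⟩
    h + h       ≤⟨ m≤m+n (h + h) e ⟩
    d           ≡⟨ α+u≡d ⟨
    α + u       ∎)
    where open ≤-Reasoning

  e≤1 : e ≤ 1
  e≤1 = ⟦⟧≤1 ε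

  -- With k = 2h + x, a larger α would force x² + 2 ≤ 2ex.
  2α≤1+k : α + α ≤ suc k
  2α≤1+k = ≮⇒≥ absurd
    where
    open ≤-Reasoning
    x = k ∸ (h + h)
    k≡ : h + h + x ≡ k
    k≡ = m+[n∸m]≡n (<⇒≤ 2h<k)
    hf<[1+u]k : h * f < suc u * k
    hf<[1+u]k = begin-strict
      h * f                           ≡⟨ m≡m%n+[m/n]*n (h * f) k ⟩
      (h * f) % k + u * k             <⟨ +-monoˡ-< (u * k) (m%n<n (h * f) k) ⟩
      suc u * k                       ∎
    expandˡ : ∀ h e x → (h + h + x) * (h + h + x) + 2 * (1 + h * (h + h + (e + e))) ≡
                        (8 * (h * h) + 4 * (h * x) + 4 * (h * e)) + (x * x + 2)
    expandˡ = solve-∀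
    expandʳ : ∀ h e x → 2 * ((h + h + e) * (h + h + x)) ≡
                        (8 * (h * h) + 4 * (h * x) + 4 * (h * e)) + 2 * (e * x)
    expandʳ = solve-∀
    collect : ∀ k u → k * k + 2 * (suc u * k) ≡ (suc (suc k) + (u + u)) * k
    collect = solve-∀
    collect′ : ∀ α u k → (α + α + (u + u)) * k ≡ 2 * ((α + u) * k)
    collect′ = solve-∀
    -- The difference of the two sides is (x - 1)² + 1.
    2x<x²+2 : ∀ x → 2 * x < x * x + 2
    2x<x²+2 zero    = z<s
    2x<x²+2 (suc y) = begin-strict
      2 * suc y                    <⟨ n<1+n (2 * suc y) ⟩
      1 + 2 * suc y                ≤⟨ m≤m+n _ (y * y) ⟩
      1 + 2 * suc y + y * y        ≡⟨ square y ⟩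
      suc y * suc y + 2            ∎
      where
      square : ∀ y → 1 + 2 * suc y + y * y ≡ suc y * suc y + 2
      square = solve-∀
    absurd : ¬ (suc k < α + α)
    absurd 1+k<2α = <⇒≱ (2x<x²+2 x) (≤-trans x²+2≤2ex (*-monoʳ-≤ 2 (≤-trans (*-monoˡ-≤ x e≤1) (≤-reflexive (*-identityˡ x)))))
      where
      x²+2≤2ex : x * x + 2 ≤ 2 * (e * x)
      -- The assumption `2 + k ≤ α + α` is multiplied by `k`, and 2uk is added to bring in
      -- `α + u ≡ d`. On the smaller side `suc u * k` is bounded below by `1 + h * f`, and `f` by 2h
      -- + 2e.
      x²+2≤2ex = +-cancelˡ-≤ (8 * (h * h) + 4 * (h * x) + 4 * (h * e)) _ _ (begin
        (8 * (h * h) + 4 * (h * x) + 4 * (h * e)) + (x * x + 2)            ≡⟨ expandˡ h e x ⟨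
        (h + h + x) * (h + h + x) + 2 * (1 + h * (h + h + (e + e)))        ≡⟨ cong (λ z → z * z + 2 * (1 + h * (h + h + (e + e)))) k≡ ⟩
        k * k + 2 * (1 + h * (h + h + (e + e)))                            ≤⟨ +-monoʳ-≤ (k * k) (*-monoʳ-≤ 2 (s≤s (*-monoʳ-≤ h enough))) ⟩
        k * k + 2 * (1 + h * f)                                            ≤⟨ +-monoʳ-≤ (k * k) (*-monoʳ-≤ 2 hf<[1+u]k) ⟩
        k * k + 2 * (suc u * k)                                            ≡⟨ collect k u ⟩
        (suc (suc k) + (u + u)) * k                                        ≤⟨ *-monoˡ-≤ k (+-monoˡ-≤ (u + u) 1+k<2α) ⟩
        (α + α + (u + u)) * k                                              ≡⟨ collect′ α u k ⟩
        2 * ((α + u) * k)                                                  ≡⟨ cong₂ (λ y z → 2 * (y * z)) α+u≡d (sym k≡) ⟩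
        2 * ((h + h + e) * (h + h + x))                                    ≡⟨ expandʳ h e x ⟩
        (8 * (h * h) + 4 * (h * x) + 4 * (h * e)) + 2 * (e * x)            ∎)

  α≤k : α ≤ k
  α≤k = s≤s⁻¹ (begin
    suc α      ≤⟨ +-monoˡ-≤ α (≤-trans (s≤s z≤n) h≤α) ⟩
    α + α      ≤⟨ 2α≤1+k ⟩
    suc k      ∎)
    where open ≤-Reasoning

  N : ℕ → ℕ
  N t = (t * f) / k

  -- As `f < k`, the carry in `F` occurs exactly when ⌊tf/k⌋ jumps between `t` and t + 1. This
  -- spreads `f` residues as evenly as possible.
  F R : ℕ → Bool
  F t = carry k (t * f) f
  R i = carry k (i * f) (h * f)

  F-periodic : Periodic k (⟦_⟧ ∘ F)
  F-periodic t = cong ⟦_⟧ (carry-periodic k f f t)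

  R-periodic : Periodic k (⟦_⟧ ∘ R)
  R-periodic i = cong ⟦_⟧ (carry-periodic k f (h * f) i)

  N-suc : ∀ t → N (suc t) ≡ N t + ⟦ F t ⟧
  N-suc t = begin
    (f + t * f) / k              ≡⟨ cong (_/ k) (+-comm f (t * f)) ⟩
    (t * f + f) / k              ≡⟨ /-carry k (t * f) f ⟩
    N t + f / k + ⟦ F t ⟧        ≡⟨ cong (λ z → N t + z + ⟦ F t ⟧) (m<n⇒m/n≡0 f<k) ⟩
    N t + 0 + ⟦ F t ⟧            ≡⟨ cong (_+ ⟦ F t ⟧) (+-identityʳ (N t)) ⟩
    N t + ⟦ F t ⟧                ∎
    where open ≡-Reasoning

  N-telescope : ∀ i m → N i + ∑< m (λ x → ⟦ F (i + x) ⟧) ≡ N (i + m)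
  N-telescope i zero    = trans (+-identityʳ (N i)) (cong N (sym (+-identityʳ i)))
  N-telescope i (suc m) = begin
    N i + ∑< (suc m) (λ x → ⟦ F (i + x) ⟧)              ≡⟨ cong (N i +_) (∑<-last m (λ x → ⟦ F (i + x) ⟧)) ⟩
    N i + (∑< m (λ x → ⟦ F (i + x) ⟧) + ⟦ F (i + m) ⟧)  ≡⟨ +-assoc (N i) _ _ ⟨
    N i + ∑< m (λ x → ⟦ F (i + x) ⟧) + ⟦ F (i + m) ⟧    ≡⟨ cong (_+ ⟦ F (i + m) ⟧) (N-telescope i m) ⟩
    N (i + m) + ⟦ F (i + m) ⟧                           ≡⟨ N-suc (i + m) ⟨
    N (suc (i + m))                                     ≡⟨ cong N (+-suc i m) ⟨
    N (i + suc m)                                       ∎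
    where open ≡-Reasoning

  -- The count telescopes to the increase of `N` over the window, and adding `h * f` carries at most
  -- once.
  F-window : ∀ i → ∑< h (λ x → ⟦ F (i + x) ⟧) ≡ u + ⟦ R i ⟧
  F-window i = +-cancelˡ-≡ (N i) _ _ (begin
    N i + ∑< h (λ x → ⟦ F (i + x) ⟧)   ≡⟨ N-telescope i h ⟩
    ((i + h) * f) / k                  ≡⟨ cong (_/ k) (*-distribʳ-+ f i h) ⟩
    (i * f + h * f) / k                ≡⟨ /-carry k (i * f) (h * f) ⟩
    N i + u + ⟦ R i ⟧                  ≡⟨ +-assoc (N i) u _ ⟩
    N i + (u + ⟦ R i ⟧)                ∎)
    where open ≡-Reasoning

  F-total : ∑< k (⟦_⟧ ∘ F) ≡ f
  F-total = begin
    ∑< k (⟦_⟧ ∘ F)         ≡⟨ cong (_+ ∑< k (⟦_⟧ ∘ F)) (0/n≡0 k) ⟨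
    N 0 + ∑< k (⟦_⟧ ∘ F)   ≡⟨ N-telescope 0 k ⟩
    (k * f) / k            ≡⟨ cong (_/ k) (*-comm k f) ⟩
    (f * k) / k            ≡⟨ m*n/n≡m f k ⟩
    f                      ∎
    where open ≡-Reasoning

  enumeration = enumerate {k} {f} (F ∘ toℕ) F-total

  τ : Fin f → Fin k
  τ = proj₁ enumeration

  sum-τ : ∀ (w : ℕ → ℕ) → sum (λ s → w (toℕ (τ s))) ≡ ∑< k (λ t → ⟦ F t ⟧ * w t)
  sum-τ w = proj₁ (proj₂ enumeration) (w ∘ toℕ)

  τ-injective : ∀ s t → τ s ≡ τ t → s ≡ t
  τ-injective = proj₂ (proj₂ enumeration)

  -- Difference `g` is chosen because `aᵢ` and the b at index i + g see the same window of `F`, from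
  -- `i` to i + g. If it holds u + 1 elements, deleting the edge between them corrects both degrees
  -- at once.
  M₀ : ℕ → ℕ → Bool
  M₀ i j = does (δ i j <? α) ∧ not (R i ∧ does (δ i j ≟ g))

  M₀⇒δ<α : ∀ i j → M₀ i j ≡ true → δ i j < α
  M₀⇒δ<α i j Mij = holds (δ i j <? α) (proj₁ (∧-true Mij))

  M₀-masked : ∀ i j → ⟦ M₀ i j ⟧ + ⟦ R i ⟧ * ⟦ does (δ i j ≟ g) ⟧ ≡ ⟦ does (δ i j <? α) ⟧
  M₀-masked i j = masked _ (does (δ i j ≟ g)) (R i)
    (λ eq → dec-true (δ i j <? α) (subst (_< α) (sym (holds (δ i j ≟ g) eq)) h≤α))

  balance : ∀ x y r → x + r ≡ α → y ≡ u + r → x + y ≡ d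
  balance x y r x+r≡α y≡u+r = begin
    x + y          ≡⟨ cong (x +_) (trans y≡u+r (+-comm u r)) ⟩
    x + (r + u)    ≡⟨ +-assoc x r u ⟨
    x + r + u      ≡⟨ cong (_+ u) x+r≡α ⟩
    α + u          ≡⟨ α+u≡d ⟩
    d              ∎
    where open ≡-Reasoning

  row-a₀ : ∀ {i} → i < k → ∑< k (λ j → ⟦ M₀ i j ⟧) + sum (λ s → ⟦ does (δ i (toℕ (τ s)) <? h) ⟧) ≡ d
  row-a₀ {i} i<k = balance _ _ ⟦ R i ⟧ M-sum P-sum
    where
    open ≡-Reasoning
    removed : ∑< k (λ j → ⟦ R i ⟧ * ⟦ does (δ i j ≟ g) ⟧) ≡ ⟦ R i ⟧
    removed = trans (δ-row (λ _ → ⟦ R i ⟧) (λ x → ⟦ does (x ≟ g) ⟧) (λ _ → refl) (<⇒≤ i<k)) (∑<-point (λ _ → ⟦ R i ⟧) (<⇒≤ h<k))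
    M-sum : ∑< k (λ j → ⟦ M₀ i j ⟧) + ⟦ R i ⟧ ≡ α
    M-sum = begin
      ∑< k (λ j → ⟦ M₀ i j ⟧) + ⟦ R i ⟧                                                 ≡⟨ cong (∑< k (λ j → ⟦ M₀ i j ⟧) +_) removed ⟨
      ∑< k (λ j → ⟦ M₀ i j ⟧) + ∑< k (λ j → ⟦ R i ⟧ * ⟦ does (δ i j ≟ g) ⟧)             ≡⟨ ∑-distrib-+ {k} (λ j → ⟦ M₀ i (toℕ j) ⟧) (λ j → ⟦ R i ⟧ * ⟦ does (δ i (toℕ j) ≟ g) ⟧) ⟨
      ∑< k (λ j → ⟦ M₀ i j ⟧ + ⟦ R i ⟧ * ⟦ does (δ i j ≟ g) ⟧)                          ≡⟨ ∑<-cong k (λ j _ → M₀-masked i j) ⟩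
      ∑< k (λ j → ⟦ does (δ i j <? α) ⟧)                                                ≡⟨ δ-row-window α≤k (<⇒≤ i<k) ⟩
      α                                                                                 ∎
    P-sum : sum (λ s → ⟦ does (δ i (toℕ (τ s)) <? h) ⟧) ≡ u + ⟦ R i ⟧
    P-sum = begin
      sum (λ s → ⟦ does (δ i (toℕ (τ s)) <? h) ⟧)            ≡⟨ sum-τ (λ t → ⟦ does (δ i t <? h) ⟧) ⟩
      ∑< k (λ t → ⟦ F t ⟧ * ⟦ does (δ i t <? h) ⟧)           ≡⟨ δ-row (⟦_⟧ ∘ F) (λ x → ⟦ does (x <? h) ⟧) F-periodic (<⇒≤ i<k) ⟩
      ∑< k (λ x → ⟦ F (i + x) ⟧ * ⟦ does (x <? h) ⟧)         ≡⟨ ∑<-prefix (λ x → ⟦ F (i + x) ⟧) (<⇒≤ h<k) ⟩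
      ∑< h (λ x → ⟦ F (i + x) ⟧)                             ≡⟨ F-window i ⟩
      u + ⟦ R i ⟧                                            ∎

  row-b₀ : ∀ {j} → j < k → ∑< k (λ i → ⟦ M₀ i j ⟧) + sum (λ s → ⟦ does (δ (toℕ (τ s)) j <? h) ⟧) ≡ d
  row-b₀ {j} j<k = balance _ _ ⟦ R o ⟧ M-sum Q-sum
    where
    open ≡-Reasoning
    -- This represents j - g: the start of the window ending at `j`, and the row whose deletion
    -- would affect column `j`.
    o = suc j + (k ∸ h)
    removed : ∑< k (λ i → ⟦ R i ⟧ * ⟦ does (δ i j ≟ g) ⟧) ≡ ⟦ R o ⟧
    removed = trans (δ-col (⟦_⟧ ∘ R) (λ x → ⟦ does (x ≟ g) ⟧) R-periodic j<k) (∑<-point (λ x → ⟦ R (suc j + (k ∸ suc x)) ⟧) (<⇒≤ h<k))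
    M-sum : ∑< k (λ i → ⟦ M₀ i j ⟧) + ⟦ R o ⟧ ≡ α
    M-sum = begin
      ∑< k (λ i → ⟦ M₀ i j ⟧) + ⟦ R o ⟧                                                 ≡⟨ cong (∑< k (λ i → ⟦ M₀ i j ⟧) +_) removed ⟨
      ∑< k (λ i → ⟦ M₀ i j ⟧) + ∑< k (λ i → ⟦ R i ⟧ * ⟦ does (δ i j ≟ g) ⟧)             ≡⟨ ∑-distrib-+ {k} (λ i → ⟦ M₀ (toℕ i) j ⟧) (λ i → ⟦ R (toℕ i) ⟧ * ⟦ does (δ (toℕ i) j ≟ g) ⟧) ⟨
      ∑< k (λ i → ⟦ M₀ i j ⟧ + ⟦ R i ⟧ * ⟦ does (δ i j ≟ g) ⟧)                          ≡⟨ ∑<-cong k (λ i _ → M₀-masked i j) ⟩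
      ∑< k (λ i → ⟦ does (δ i j <? α) ⟧)                                                ≡⟨ δ-col-window α≤k j<k ⟩
      α                                                                                 ∎
    regroup : ∀ x → x < h → suc j + (k ∸ suc (h ∸ suc x)) ≡ o + x
    regroup x x<h = begin
      suc j + (k ∸ suc (h ∸ suc x))   ≡⟨ cong (λ z → suc j + (k ∸ z)) (+-∸-assoc 1 x<h) ⟨
      suc j + (k ∸ (h ∸ x))           ≡⟨ cong (suc j +_) (m∸[n∸o]≡m∸n+o k (<⇒≤ h<k) (<⇒≤ x<h)) ⟩
      suc j + (k ∸ h + x)             ≡⟨ +-assoc (suc j) (k ∸ h) x ⟨
      o + x                           ∎
      where
      m∸[n∸o]≡m∸n+o : ∀ m {n o} → n ≤ m → o ≤ n → m ∸ (n ∸ o) ≡ m ∸ n + o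
      m∸[n∸o]≡m∸n+o m {n} {o} n≤m o≤n = +-cancelʳ-≡ (n ∸ o) _ _ (begin
        m ∸ (n ∸ o) + (n ∸ o)   ≡⟨ m∸n+n≡m (≤-trans (m∸n≤m n o) n≤m) ⟩
        m                       ≡⟨ m∸n+n≡m n≤m ⟨
        m ∸ n + n               ≡⟨ cong (m ∸ n +_) (m+[n∸m]≡n o≤n) ⟨
        m ∸ n + (o + (n ∸ o))   ≡⟨ +-assoc (m ∸ n) o (n ∸ o) ⟨
        m ∸ n + o + (n ∸ o)     ∎)
    Q-sum : sum (λ s → ⟦ does (δ (toℕ (τ s)) j <? h) ⟧) ≡ u + ⟦ R o ⟧
    Q-sum = begin
      sum (λ s → ⟦ does (δ (toℕ (τ s)) j <? h) ⟧)                      ≡⟨ sum-τ (λ t → ⟦ does (δ t j <? h) ⟧) ⟩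
      ∑< k (λ t → ⟦ F t ⟧ * ⟦ does (δ t j <? h) ⟧)                     ≡⟨ δ-col (⟦_⟧ ∘ F) (λ x → ⟦ does (x <? h) ⟧) F-periodic j<k ⟩
      ∑< k (λ x → ⟦ F (suc j + (k ∸ suc x)) ⟧ * ⟦ does (x <? h) ⟧)     ≡⟨ ∑<-prefix (λ x → ⟦ F (suc j + (k ∸ suc x)) ⟧) (<⇒≤ h<k) ⟩
      ∑< h (λ x → ⟦ F (suc j + (k ∸ suc x)) ⟧)                         ≡⟨ ∑<-reverse h (λ x → ⟦ F (suc j + (k ∸ suc x)) ⟧) ⟨
      ∑< h (λ x → ⟦ F (suc j + (k ∸ suc (h ∸ suc x))) ⟧)               ≡⟨ ∑<-cong h (λ x x<h → cong (⟦_⟧ ∘ F) (regroup x x<h)) ⟩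
      ∑< h (λ x → ⟦ F (o + x) ⟧)                                       ≡⟨ F-window o ⟩
      u + ⟦ R o ⟧                                                      ∎

  -- For odd `d` the c's are matched by reversal, `s` with f - 1 - s. By `even` no c is its own
  -- partner.
  T₀ : Fin f → Fin f → Bool
  T₀ s t = does (s Fin.≟ t) ∨ (ε ∧ does (suc (toℕ s + toℕ t) ≟ f))

  T₀-sym : ∀ s t → T₀ s t ≡ T₀ t s
  T₀-sym s t = cong₂ (λ x y → x ∨ (ε ∧ y)) (does-≟-sym s t) (cong (λ z → does (suc z ≟ f)) (+-comm (toℕ s) (toℕ t)))

  T₀-count : ∀ s → sum (λ t → ⟦ T₀ s t ⟧) ≡ 1 + e
  T₀-count s = begin
    sum (λ t → ⟦ T₀ s t ⟧)                                                                   ≡⟨ sum-cong-≗ disjoint ⟩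
    sum (λ t → ⟦ does (s Fin.≟ t) ⟧ + e * ⟦ does (suc (toℕ s + toℕ t) ≟ f) ⟧)                ≡⟨ ∑-distrib-+ (λ t → ⟦ does (s Fin.≟ t) ⟧) (λ t → e * ⟦ does (suc (toℕ s + toℕ t) ≟ f) ⟧) ⟩
    sum (λ t → ⟦ does (s Fin.≟ t) ⟧) + ∑< f (λ t → e * ⟦ does (suc (toℕ s + t) ≟ f) ⟧)       ≡⟨ cong₂ _+_ (sum-indicator s) (∑<-cong f (λ t _ → cong (λ b → e * ⟦ b ⟧) (partner t))) ⟩
    1 + ∑< f (λ t → e * ⟦ does (t ≟ f ∸ suc (toℕ s)) ⟧)                                      ≡⟨ cong suc (∑<-point (λ _ → e) (∸-monoʳ-< z<s (Fin.toℕ<n s))) ⟩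
    1 + e                                                                                    ∎
    where
    open ≡-Reasoning
    disjoint : ∀ t → ⟦ T₀ s t ⟧ ≡ ⟦ does (s Fin.≟ t) ⟧ + e * ⟦ does (suc (toℕ s + toℕ t) ≟ f) ⟧
    disjoint t = disjoint-∨ (does (s Fin.≟ t)) ε _ λ s≡t ε≡true →
      dec-false (suc (toℕ s + toℕ t) ≟ f)
        (subst (λ t → suc (toℕ s + toℕ t) ≢ f) (holds (s Fin.≟ t) s≡t) (even ε≡true (toℕ s)))
    partner : ∀ t → does (suc (toℕ s + t) ≟ f) ≡ does (t ≟ f ∸ suc (toℕ s))
    partner t = does-⇔ (mk⇔ (λ eq → trans (sym (m+n∸m≡n (suc (toℕ s)) t)) (cong (_∸ suc (toℕ s)) eq))
                            (λ eq → trans (cong (suc (toℕ s) +_) eq) (m+[n∸m]≡n (Fin.toℕ<n s))))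
                       (suc (toℕ s + t) ≟ f) (t ≟ f ∸ suc (toℕ s))

  self-adjacent : ∀ {i} → i < k → does (δ i i <? h) ≡ true
  self-adjacent {i} i<k = dec-true (δ i i <? h) (subst (_< h) (sym (δ-self i<k)) z<s)

  -- Differences in the two directions between distinct residues add up to `k`, which exceeds 2h, so
  -- they are not both below `h`.
  meet : ∀ {i t} → i < k → t < k → δ i t < h → δ t i < h → i ≡ t
  meet {i} {t} i<k t<k it ti with <-cmp i t
  ... | tri≈ _ i≡t _ = i≡t
  ... | tri< i<t _ _ = contradiction (subst (_< h + h) (antipodal k i<t t<k) (+-mono-< it ti)) (<⇒≯ 2h<k)
  ... | tri> _ _ t<i = contradiction (subst (_< h + h) (antipodal k t<i i<k) (+-mono-< ti it)) (<⇒≯ 2h<k)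

  -- Deletions happen at difference `g`, and `0 < g` keeps them off the diagonal.
  M₀-diag : ∀ {i} → i < k → M₀ i i ≡ true
  M₀-diag {i} i<k rewrite δ-self i<k | dec-true (0 <? α) (≤-trans z<s h≤α) | dec-false (0 ≟ g) (<⇒≢ 0<g)
    = cong not (∧-zeroʳ (R i))

  design : Design k f d
  design = record
    { M = λ i j → M₀ (toℕ i) (toℕ j)
    ; P = λ i s → does (δ (toℕ i) (toℕ (τ s)) <? h)
    ; Q = λ j s → does (δ (toℕ (τ s)) (toℕ j) <? h)
    ; T = T₀
    ; T-sym = T₀-sym
    ; row-a = λ i → row-a₀ (Fin.toℕ<n i)
    ; row-b = λ j → row-b₀ (Fin.toℕ<n j)
    ; row-c = λ s → trans (cong₂ _+_ (δ-col-window (<⇒≤ h<k) (Fin.toℕ<n (τ s)))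
                      (cong₂ _+_ (δ-row-window (<⇒≤ h<k) (<⇒≤ (Fin.toℕ<n (τ s)))) (T₀-count s))) (total h e)
    ; φ = τ
    ; M-diag = λ i → M₀-diag (Fin.toℕ<n i)
    ; P-φ = λ s → self-adjacent (Fin.toℕ<n (τ s))
    ; Q-φ = λ s → self-adjacent (Fin.toℕ<n (τ s))
    ; T-φ = λ s t eq → cong (_∨ (ε ∧ does (suc (toℕ s + toℕ t) ≟ f))) (dec-true (s Fin.≟ t) (τ-injective s t eq))
    ; φ-unique = λ i s Pis Qis → Fin.toℕ-injective (meet (Fin.toℕ<n i) (Fin.toℕ<n (τ s)) (holds (_ <? h) Pis) (holds (_ <? h) Qis))
    -- There are `α` indices below the cut, few enough for a band of width `α` because 2α ≤ k + 1.
    -- The k - α indices beyond it always fit, and row 0 of the band ends just before the cut.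
    ; cut = α
    ; cut>0 = ≤-trans z<s h≤α
    ; M-low = λ i j Mij i<α _ → δ-triangular {o = 0} (Fin.toℕ<n i) (M₀⇒δ<α (toℕ i) (toℕ j) Mij) z≤n
                (≤-trans (s≤s⁻¹ (≤-trans (+-monoˡ-≤ α i<α) 2α≤1+k)) (m≤m+n k 0))
    ; M-high = λ i j Mij _ α≤j → δ-triangular {o = α} (Fin.toℕ<n i) (M₀⇒δ<α (toℕ i) (toℕ j) Mij) α≤j
                (+-monoˡ-≤ α (<⇒≤ (Fin.toℕ<n i)))
    ; M-zero = λ i j Mij i≡0 → subst (_< α) (trans (cong (λ z → δ z (toℕ j)) i≡0) (δ-forward z≤n (Fin.toℕ<n j)))
                (M₀⇒δ<α (toℕ i) (toℕ j) Mij)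
    }
    where
    total : ∀ h e → h + (h + (1 + e)) ≡ suc (h + h + e)
    total = solve-∀

-- Parity and the choice of construction

odd≢even : ∀ a b → suc (a + a) ≢ b + b
odd≢even zero    (suc b) eq with () ← trans eq (cong suc (+-suc b b))
odd≢even (suc a) (suc b) eq = odd≢even a b (suc-injective (trans (sym (cong suc (+-suc a a))) (trans (suc-injective eq) (+-suc b b))))

halve : ∀ n → ∃[ m ] ∃[ b ] n ≡ m + m + ⟦ b ⟧
halve zero = 0 , false , refl
halve (suc n) with halve n
... | m , false , eq = m , true , trans (cong suc eq) (+-suc′ (m + m))
  where
  +-suc′ : ∀ x → suc (x + 0) ≡ x + 1
  +-suc′ = solve-∀
... | m , true  , eq = suc m , false , trans (cong suc eq) (double m)
  where
  double : ∀ m → suc (m + m + 1) ≡ suc m + suc m + 0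
  double = solve-∀

Compatible : ℕ → ℕ → Set
Compatible d f = ∀ a b → d ≡ suc (a + a) → f ≢ suc (b + b)

-- The case split is on ⌊d/2⌋: the value 1 is left to the cliques, since the balanced construction
-- asks for h ≥ 2.
design-exists : ∀ k f d → 2 ≤ d → d ≤ f → 2 + f ≤ k → Compatible d f → Design k f d
design-exists k f d 2≤d d≤f 2+f≤k compatible with halve d
... | 0 , b , refl = contradiction (≤-trans 2≤d (⟦⟧≤1 b)) 1+n≰n
-- For d = 2 there are `f` triangles, each containing one c.
... | 1 , false , refl = subst₂ (λ k f → Design k f 2) (m+[n∸m]≡n f≤k) (*-identityˡ f)
        (Cliques.design f (k ∸ f) 1 {{>-nonZero (≤-trans z<s d≤f)}} {{>-nonZero (≤-trans z<s 2≤p)}} z<s 2≤p)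
  where
  f≤k : f ≤ k
  f≤k = ≤-trans (m≤n+m f 2) 2+f≤k
  2≤p : 2 ≤ k ∸ f
  2≤p = m+n≤o⇒m≤o∸n 2 2+f≤k
... | 1 , true , refl with halve f
...   | q , true  , refl = contradiction (+-comm (q + q) 1) (compatible 1 q refl)
-- For d = 3 compatibility makes `f` even, and each of the q = f/2 copies of K₄ contains two c's.
-- From d ≤ f follows q ≥ 2, hence k - q ≥ 4.
...   | q , false , refl = subst₂ (λ k f → Design k f 3) (m+[n∸m]≡n q≤k) 2q≡f
        (Cliques.design q (k ∸ q) 2 {{>-nonZero (≤-trans z<s 2≤q)}} {{>-nonZero (≤-trans z<s 4≤p)}} z<s 4≤p)
  where
  2q≡f : 2 * q ≡ q + q + 0
  2q≡f = trans (cong (q +_) (+-identityʳ q)) (sym (+-identityʳ (q + q)))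
  2≤q : 2 ≤ q
  2≤q = ≮⇒≥ λ q<2 → 1+n≰n (≤-trans d≤f (≤-trans (≤-reflexive (+-identityʳ (q + q))) (+-mono-≤ (s≤s⁻¹ q<2) (s≤s⁻¹ q<2))))
  4+q≤k : 4 + q ≤ k
  4+q≤k = begin
    2 + (2 + q)       ≤⟨ +-monoʳ-≤ 2 (+-monoˡ-≤ q 2≤q) ⟩
    2 + (q + q)       ≡⟨ cong (2 +_) (+-identityʳ (q + q)) ⟨
    2 + (q + q + 0)   ≤⟨ 2+f≤k ⟩
    k                 ∎
    where open ≤-Reasoning
  q≤k : q ≤ k
  q≤k = ≤-trans (m≤n+m q 4) 4+q≤k
  4≤p : 4 ≤ k ∸ q
  4≤p = m+n≤o⇒m≤o∸n 4 4+q≤k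
design-exists k f d 2≤d d≤f 2+f≤k compatible | suc (suc m) , b , refl =
  Balanced.design k f (suc m) b {{>-nonZero (≤-trans z<s 2+f≤k)}} z<s (enough b d≤f compatible) (≤-trans (n≤1+n (suc f)) 2+f≤k)
    (λ { refl x eq → compatible (2 + m) x (+-comm _ 1) (sym eq) })
  where
  h = 2 + m
  -- For odd `d`, compatibility rules out d = f, which gains the extra unit.
  enough : ∀ b → h + h + ⟦ b ⟧ ≤ f → Compatible (h + h + ⟦ b ⟧) f → h + h + (⟦ b ⟧ + ⟦ b ⟧) ≤ f
  enough false ≤f _ = ≤f
  enough true  ≤f compatible with m≤n⇒m<n∨m≡n ≤f
  ... | inj₁ <f = subst (_≤ f) (sym (+-suc (h + h) 1)) <f
  ... | inj₂ ≡f = contradiction (trans (sym ≡f) (+-comm (h + h) 1)) (compatible h h (+-comm (h + h) 1))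

-- If `d` and `f` were both odd, n = 2k + f would be odd, and so would r = n - 1 - d. Then n r is
-- odd, against the handshake lemma.
regular⇒compatible : ∀ k {n r f d} (G : Graph n) → Regular r G → r + suc d ≡ n → n ≡ k + (k + f) → Compatible d f
regular⇒compatible k {r = r} G regular r+1+d≡n n≡2k+f a b refl refl with halve r | handshake G regular
... | y , false , refl | _ = odd≢even (k + b) (y + suc a) (trans (oddˡ k b) (trans (sym (trans r+1+d≡n n≡2k+f)) (evenʳ y a)))
  where
  oddˡ : ∀ k b → suc ((k + b) + (k + b)) ≡ k + (k + suc (b + b))
  oddˡ = solve-∀
  evenʳ : ∀ y a → y + y + 0 + suc (suc (a + a)) ≡ (y + suc a) + (y + suc a)
  evenʳ = solve-∀
... | y , true , refl | m , nr≡m+m =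
  -- The witness is half of n r - 1, for n = 2(k + b) + 1 and r = 2y + 1.
  odd≢even (2 * ((k + b) * y) + (k + b) + y) m (trans (odd k b y) (trans (cong (_* (y + y + 1)) (sym n≡2k+f)) nr≡m+m))
  where
  odd : ∀ k b y → suc ((2 * ((k + b) * y) + (k + b) + y) + (2 * ((k + b) * y) + (k + b) + y)) ≡ (k + (k + suc (b + b))) * (y + y + 1)
  odd = solve-∀

-- The parameters `d` and `f` of a given regular graph

module _ {n r k} (4≤k : 4 ≤ k) (2k≤n : 2 * k ≤ n) (n≤3k∸2 : n ≤ 3 * k ∸ 2) (2k∸2<r : 2 * (k ∸ 1) < r) where

  f : ℕ
  f = n ∸ 2 * k

  n≡2k+f : n ≡ k + (k + f)
  n≡2k+f = trans (sym (m+[n∸m]≡n 2k≤n)) (assoc k f)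
    where
    assoc : ∀ k f → 2 * k + f ≡ k + (k + f)
    assoc = solve-∀

  2+f≤k : 2 + f ≤ k
  2+f≤k = +-cancelˡ-≤ (2 * k) _ _ (begin
    2 * k + (2 + f)     ≡⟨ swap k f ⟩
    2 + (2 * k + f)     ≡⟨ cong (2 +_) (m+[n∸m]≡n 2k≤n) ⟩
    2 + n               ≤⟨ +-monoʳ-≤ 2 n≤3k∸2 ⟩
    -- The truncated subtraction is a true difference, as k ≥ 4.
    2 + (3 * k ∸ 2)     ≡⟨ m+[n∸m]≡n (≤-trans (≤-trans (s≤s (s≤s z≤n)) 4≤k) (m≤m+n k _)) ⟩
    3 * k               ≡⟨ triple k ⟩
    2 * k + k           ∎)
    where
    open ≤-Reasoning
    swap : ∀ k f → 2 * k + (2 + f) ≡ 2 + (2 * k + f)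
    swap = solve-∀
    triple : ∀ k → 3 * k ≡ 2 * k + k
    triple = solve-∀

  2k≤1+r : 2 * k ≤ suc r
  2k≤1+r = begin
    2 * k               ≡⟨ cong (2 *_) (m+[n∸m]≡n {1} {k} (≤-trans (s≤s z≤n) 4≤k)) ⟨
    2 * (1 + (k ∸ 1))   ≡⟨ *-distribˡ-+ 2 1 (k ∸ 1) ⟩
    2 + 2 * (k ∸ 1)     ≤⟨ s≤s 2k∸2<r ⟩
    suc r               ∎
    where open ≤-Reasoning

  module _ (G : Graph n) (regular : Regular r G) (colourable : Colorable G k) where

    r+codegree : ∀ v → r + codegree G v ≡ n
    r+codegree v = trans (cong (_+ codegree G v) (sym (regular v))) (degree+codegree G v)

    d : ℕ
    d = n ∸ suc r

    r<n : r < n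
    r<n = subst (r <_) (r+codegree v) (m<m+n r (codegree-positive G v))
      where
      v : Fin n
      v = fromℕ< {0} (≤-trans (*-mono-≤ {1} {2} (s≤s z≤n) (≤-trans (s≤s z≤n) 4≤k)) 2k≤n)

    r+1+d≡n : r + suc d ≡ n
    r+1+d≡n = trans (+-suc r d) (m+[n∸m]≡n r<n)

    n≤k[1+d] : n ≤ k * suc d
    n≤k[1+d] = colourable-bound G (λ v → +-cancelˡ-≡ r _ _ (trans (r+codegree v) (sym r+1+d≡n))) colourable

    d≤f : d ≤ f
    d≤f = +-cancelˡ-≤ (2 * k) _ _ (begin
      2 * k + d     ≤⟨ +-monoˡ-≤ d 2k≤1+r ⟩
      suc r + d     ≡⟨ m+[n∸m]≡n r<n ⟩
      n             ≡⟨ m+[n∸m]≡n 2k≤n ⟨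
      2 * k + f     ∎)
      where open ≤-Reasoning

    instance
      k≢0 : NonZero k
      k≢0 = >-nonZero (≤-trans z<s 4≤k)

    1≤d : 1 ≤ d
    1≤d = s≤s⁻¹ (*-cancelˡ-≤ k (≤-trans (≤-trans (≤-reflexive (*-comm k 2)) 2k≤n) n≤k[1+d]))

    -- A bootstrap: `1 ≤ d` and `d ≤ f` make 2k < n strict, which improves the same colour-class
    -- estimate by one.
    2≤d : 2 ≤ d
    2≤d = s≤s⁻¹ (*-cancelˡ-< k 2 (suc d) (begin-strict
      k * 2        ≡⟨ *-comm k 2 ⟩
      2 * k        <⟨ m<m+n (2 * k) (≤-trans 1≤d d≤f) ⟩
      2 * k + f    ≡⟨ m+[n∸m]≡n 2k≤n ⟩
      n            ≤⟨ n≤k[1+d] ⟩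
      k * suc d    ∎))
      where open ≤-Reasoning

    -- The given graph yields the conditions on `d` and `f`; the graph attaining k - 1 is that of a
    -- design.
    defNum : DefNum n r k (k ∸ 1)
    defNum = subst (λ n → DefNum n r k (k ∸ 1)) (sym n≡2k+f) (design⇒DefNum
      (design-exists k f d 2≤d d≤f 2+f≤k (regular⇒compatible k G regular r+1+d≡n n≡2k+f))
      (trans r+1+d≡n n≡2k+f))

theorem3p4 : (n r k : ℕ) → 4 ≤ k → 2 * k ≤ n → n ≤ 3 * k ∸ 2 → 2 * (k ∸ 1) < r
    → Σ (Graph n) (InClass r k)
    → DefNum n r k (k ∸ 1)
theorem3p4 n r k 4≤k 2k≤n n≤3k∸2 2k∸2<r (G , regular , colourable , _) =
  defNum 4≤k 2k≤n n≤3k∸2 2k∸2<r G regular colourable
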